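{- Let $n\geq 4$ and $2\leq k\leq n-2$. If $G$ is a connected graph on $n$ vertices with exactly $k$ pendant vertices, then $F(G)\geq F\bigl(T(\lfloor k/2\rfloor,\lceil k/2\rceil,n-k)\bigr)$, with equality if and only if $G$ is isomorphic to $T(\lfloor k/2\rfloor,\lceil k/2\rceil,n-k)$.
   Context: All graphs are finite, simple and undirected. A pendant vertex is a vertex of degree one. For positive integers $k,l,d$, $T(k,l,d)$ is the tree on $k+l+d$ vertices obtained from the path $v_1v_2\cdots v_d$ by attaching $k$ new pendant vertices to $v_1$ and $l$ new pendant vertices to $v_d$. A connected subgraph of a graph $G=(V,E)$ is a graph $(V',E')$ with $\emptyset\neq V'\subseteq V$, $E'\subseteq E$, every edge of $E'$ having both endpoints in $V'$, and $(V',E')$ connected; distinct pairs $(V',E')$ are counted separately. The core index $F(G)$ is the number of connected subgraphs of $G$. -}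

module Defs where

open import Data.Nat using (ℕ; zero; suc; _+_; _∸_; _≡ᵇ_; _<ᵇ_; _≤ᵇ_)
open import Data.Fin using (Fin; toℕ)
open import Data.List using (List; map; allFin)
open import Data.Nat.ListAction using (sum)
open import Data.Bool using (Bool; true; false; _∧_; _∨_; not; if_then_else_)
open import Data.Bool.Properties using (∨-comm)
open import Data.Vec using (Vec; lookup)
open import Data.Product using (Σ; ∃; _×_)
open import Relation.Binary.PropositionalEquality using (_≡_; refl; cong; cong₂)
open import Relation.Binary.Construct.Closure.ReflexiveTransitive using (Star)
open import Function.Bundles using (_↔_; Inverse)

record Graph (n : ℕ) : Set where
  field
    adj    : Fin n → Fin n → Bool
    sym    : ∀ i j → adj i j ≡ adj j i
    irrefl : ∀ i → adj i i ≡ false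
open Graph public

Connected : ∀ {n} → Graph n → Set
Connected G = ∀ u v → Star (λ i j → adj G i j ≡ true) u v

degree : ∀ {n} → Graph n → Fin n → ℕ
degree {n} G i = sum (map (λ j → if adj G i j then 1 else 0) (allFin n))

pendantCount : ∀ {n} → Graph n → ℕ
pendantCount {n} G = sum (map (λ i → if degree G i ≡ᵇ 1 then 1 else 0) (allFin n))

_≅_ : ∀ {n m} → Graph n → Graph m → Set
_≅_ {n} {m} G H = Σ (Fin n ↔ Fin m) λ f →
  ∀ i j → adj G i j ≡ adj H (Inverse.to f i) (Inverse.to f j)

-- A connected subgraph (V', E') of G: V' a vertex subset, E' a symmetric
-- edge subset (adjacency matrix), E' ⊆ E(G), endpoints of E' in V',
-- V' nonempty, and (V', E') connected. The validity proof is irrelevant,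
-- so two connected subgraphs are equal iff their pairs (V', E') are equal.
record ConnSub {n : ℕ} (G : Graph n) : Set where
  field
    V : Vec Bool n
    E : Vec (Vec Bool n) n
    .nonempty : ∃ λ v → lookup V v ≡ true
    .symmetric : ∀ i j → lookup (lookup E i) j ≡ lookup (lookup E j) i
    .subset : ∀ i j → lookup (lookup E i) j ≡ true →
              (adj G i j ≡ true) × (lookup V i ≡ true) × (lookup V j ≡ true)
    .connected : ∀ u v → lookup V u ≡ true → lookup V v ≡ true →
                 Star (λ i j → lookup (lookup E i) j ≡ true) u v

CoreIndex : ∀ {n} → Graph n → ℕ → Set
CoreIndex G a = ConnSub G ↔ Fin a

-- The tree T(k,l,d) on k+l+d vertices (for d ≥ 1). Vertex numbering:
-- 0..k-1 : pendants attached to v₁;  k..k+d-1 : the path v₁ … v_d;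
-- k+d..k+d+l-1 : pendants attached to v_d.
private
  tarc : ℕ → ℕ → ℕ → ℕ → ℕ → Bool
  tarc k l d a b =
    ((a <ᵇ k) ∧ (b ≡ᵇ k)) ∨
    (((k ≤ᵇ a) ∧ (suc a <ᵇ k + d)) ∧ (b ≡ᵇ suc a)) ∨
    ((k + d ≤ᵇ a) ∧ (b ≡ᵇ (k + d ∸ 1)))

  tadj : ℕ → ℕ → ℕ → ℕ → ℕ → Bool
  tadj k l d a b = not (a ≡ᵇ b) ∧ (tarc k l d a b ∨ tarc k l d b a)

  eqb-sym : ∀ a b → (a ≡ᵇ b) ≡ (b ≡ᵇ a)
  eqb-sym zero zero = refl
  eqb-sym zero (suc b) = refl
  eqb-sym (suc a) zero = refl
  eqb-sym (suc a) (suc b) = eqb-sym a b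

  eqb-refl : ∀ a → (a ≡ᵇ a) ≡ true
  eqb-refl zero = refl
  eqb-refl (suc a) = eqb-refl a

  tadj-sym : ∀ k l d a b → tadj k l d a b ≡ tadj k l d b a
  tadj-sym k l d a b =
    cong₂ _∧_ (cong not (eqb-sym a b)) (∨-comm (tarc k l d a b) (tarc k l d b a))

  tadj-irr : ∀ k l d a → tadj k l d a a ≡ false
  tadj-irr k l d a rewrite eqb-refl a = refl

Tree : (k l d : ℕ) → Graph (k + l + d)
Tree k l d = record
  { adj    = λ i j → tadj k l d (toℕ i) (toℕ j)
  ; sym    = λ i j → tadj-sym k l d (toℕ i) (toℕ j)
  ; irrefl = λ i → tadj-irr k l d (toℕ i)
  }

{-# OPTIONS --safe #-}

-- Let d = n − k and let T′ be a spanning tree of G obtained by breadth-first search; its restriction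
-- to the d non-pendant vertices is again a tree.  Removing no edge, one edge or two edges of
-- that restricted tree singles out 1, 2(d−1) and C(d−1,2) distinct subtrees (for two edges,
-- the component meeting both), and each subtree S may be enlarged by any set of the ℓ(S)
-- pendant vertices attached to it.  Counting also the k single pendant vertices,
--   F(G) ≥ k + 2^k + Σₑ (2^ℓ(Aₑ) + 2^ℓ(Bₑ)) + C(d−1,2),
-- where ℓ(Aₑ) + ℓ(Bₑ) = k, so each summand is at least 2^⌊k/2⌋ + 2^⌈k/2⌉; for T(⌊k/2⌋,⌈k/2⌉,d)
-- this list is complete.  Rooting T′ at a neighbour of a pendant vertex, equality
-- forces: every edge of G lies in T′, no two non-pendant vertices share a parent (else a three-edge cut,
-- or a pendant vertex in a middle component), and only the two ends of the resulting path
-- carry pendant vertices, in balanced numbers.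

module Submission where

open import Defs hiding (sym)
open import Data.Nat using (ℕ; zero; suc; _+_; _*_; _∸_; _^_; _≤_; _<_; z≤n; s≤s; _≡ᵇ_; _<ᵇ_; _≤ᵇ_; ⌊_/2⌋; ⌈_/2⌉; _≤?_; _<?_)
open import Data.Nat.Properties using (≤-refl; ≤-trans; ≤-reflexive; ≤-antisym; <-irrefl; <⇒≤; <-≤-trans; n<1+n; n≤1+n; ≤-pred; ≤-total; ≰⇒>; ≮⇒≥; ≤∧≢⇒<; <⇒≢; <⇒≱; suc-injective; +-suc; +-comm; +-assoc; +-identityʳ; *-identityʳ; +-mono-≤; +-monoˡ-≤; +-monoʳ-≤; *-monoʳ-≤; +-cancelˡ-≤; m≤m+n; m≤n+m; ^-monoʳ-≤; m^n>0; ^-distribˡ-+-*; m+[n∸m]≡n; m∸n+n≡m; m∸n≤m; ⌊n/2⌋+⌈n/2⌉≡n; ≡ᵇ⇒≡; ≡⇒≡ᵇ; <ᵇ⇒<; <⇒<ᵇ; ≤ᵇ⇒≤; ≤⇒≤ᵇ)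
open import Data.Nat.ListAction using (sum)
open import Data.Nat.ListAction.Properties using (sum-++)
import Data.Nat as ℕ
import Data.Nat.Properties as ℕₚ
open import Data.Fin using (Fin; zero; suc; toℕ; fromℕ<; punchIn)
open import Data.Fin.Properties using (_≟_; any?; all?; injective⇒≤; toℕ-injective; toℕ-fromℕ<; toℕ<n)
import Data.Fin.Permutation as Permutation
open import Data.Bool using (Bool; true; false; _∧_; _∨_; not; if_then_else_; T)
import Data.Bool as Bool
import Data.Bool.Properties as Boolₚ
open import Data.List using (List; []; _∷_; _++_; length; map; allFin; concatMap; filter; upTo; cartesianProductWith; tabulate)
import Data.List as List
open import Data.List.Properties using (length-map; length-++; map-++; map-tabulate; length-upTo)
open import Data.List.Membership.Propositional using (_∈_; _∉_)
open import Data.List.Membership.Propositional.Properties using (∈-lookup; ∈-map⁺; ∈-map⁻; ∈-++⁺ˡ; ∈-++⁺ʳ; ∈-++⁻; ∈-filter⁺; ∈-filter⁻; ∈-allFin; ∈-upTo⁺; ∈-upTo⁻; ∈-cartesianProductWith⁺; ∈-cartesianProductWith⁻; ∈-concat⁺′; ∈-concat⁻′)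
open import Data.List.Relation.Unary.Any using (here; there; index)
open import Data.List.Relation.Unary.Any.Properties using (lookup-index)
open import Data.List.Relation.Unary.All using (All; []; _∷_)
import Data.List.Relation.Unary.All as All
import Data.List.Relation.Unary.All.Properties as Allₚ
open import Data.List.Relation.Unary.AllPairs using (AllPairs; []; _∷_)
import Data.List.Relation.Unary.AllPairs as AllPairs
import Data.List.Relation.Unary.AllPairs.Properties as AllPairsₚ
open import Data.List.Relation.Unary.Unique.Propositional using (Unique)
import Data.List.Relation.Unary.Unique.Propositional.Properties as Uniqueₚ
open import Data.List.Relation.Binary.Disjoint.Propositional using (Disjoint)
open import Data.Vec using (Vec; []; _∷_; lookup)
import Data.Vec as Vec
open import Data.Vec.Properties using (lookup∘tabulate; tabulate∘lookup; tabulate-cong)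
import Data.Vec.Properties as Vecₚ
open import Data.Product using (Σ; ∃; ∃₂; _×_; _,_; proj₁; proj₂)
open import Data.Sum using (_⊎_; inj₁; inj₂)
import Data.Sum as Sum
open import Data.Empty using (⊥; ⊥-elim)
open import Data.Unit using (tt)
open import Function using (_∘_; id; case_of_)
open import Function.Bundles using (_↔_; _⇔_; Inverse; mk↔ₛ′; mk⇔)
open import Relation.Nullary using (¬_; Dec; yes; no; does)
open import Relation.Nullary.Decidable using (_×-dec_; _⊎-dec_; _→-dec_; map′; ¬?; recompute; dec-true; dec-false)
open import Relation.Binary.PropositionalEquality using (_≡_; _≢_; refl; sym; trans; cong; cong₂; cong-app; subst; subst₂)
open import Relation.Binary.Construct.Closure.ReflexiveTransitive using (Star; ε; _◅_; _◅◅_; gmap)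
import Relation.Binary.Construct.Closure.ReflexiveTransitive as Starₚ

-- Counting with duplicate-free lists

-- Connected subgraphs need not be induced, so the obstacle is to count them by vertex sets. For the
-- lower bound each listed vertex set receives only the tree edges inside it, hence distinct sets
-- give distinct subgraphs. In a levelled graph every connected subgraph is induced, hence fixed by
-- its vertex set. One list of vertex sets therefore serves both directions: it is duplicate-free
-- for `G` and exhaustive for the extremal tree. Membership of a pendant vertex is free, so shapes
-- are compared only at non-pendant vertices; there they are told apart by the tree edges they cut,
-- and by the side of the cut that holds the root. When equality holds the list exhausts the
-- connected subgraphs of `G` and no summand has slack. Each structural claim then comes from
-- exhibiting a connected subgraph off the list or a summand that is too large. Levels serve as
-- coordinates, so that the extremal `G` and the tree T(a,b,d) fit one description and are matched
-- by comparing the sizes of their levels.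

lookup-injective : ∀ {A : Set} {xs : List A} → Unique xs → ∀ {i j} →
  List.lookup xs i ≡ List.lookup xs j → i ≡ j
lookup-injective (x∉ ∷ u) {zero}  {zero}  eq = refl
lookup-injective (x∉ ∷ u) {zero}  {suc j} eq = ⊥-elim (All.lookup x∉ (∈-lookup j) eq)
lookup-injective (x∉ ∷ u) {suc i} {zero}  eq = ⊥-elim (All.lookup x∉ (∈-lookup i) (sym eq))
lookup-injective (x∉ ∷ u) {suc i} {suc j} eq = cong suc (lookup-injective u eq)

unique-⊆⇒length≤ : ∀ {A : Set} {xs ys : List A} → Unique xs →
  (∀ {x} → x ∈ xs → x ∈ ys) → length xs ≤ length ys
unique-⊆⇒length≤ {xs = xs} {ys} u sub = injective⇒≤ {f = f} inj
  where
  f : Fin (length xs) → Fin (length ys)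
  f i = index (sub (∈-lookup i))
  inj : ∀ {i j} → f i ≡ f j → i ≡ j
  inj {i} {j} eq = lookup-injective u
    (trans (lookup-index (sub (∈-lookup i)))
    (trans (cong (List.lookup ys) eq) (sym (lookup-index (sub (∈-lookup j))))))

enumeration↔ : ∀ {A : Set} {xs : List A} → Unique xs → (∀ x → x ∈ xs) → A ↔ Fin (length xs)
enumeration↔ {xs = xs} u all = mk↔ₛ′ (index ∘ all) (List.lookup xs)
  (λ i → lookup-injective u (sym (lookup-index (all (List.lookup xs i)))))
  (λ x → sym (lookup-index (all x)))

length-unique≤ : ∀ {A : Set} {a} → A ↔ Fin a → {xs : List A} → Unique xs → length xs ≤ a
length-unique≤ e {xs} u = injective⇒≤ {f = Inverse.to e ∘ List.lookup xs}
  (λ {i} {j} eq → lookup-injective u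
    (trans (sym (Inverse.strictlyInverseʳ e _))
    (trans (cong (Inverse.from e) eq) (Inverse.strictlyInverseʳ e _))))

injective-image≤ : ∀ {A B : Set} {a} → A ↔ Fin a → (f : A → B) →
  (∀ {x y} → f x ≡ f y → x ≡ y) → {ys : List B} → (∀ x → f x ∈ ys) → a ≤ length ys
injective-image≤ e f inj {ys} mem = injective⇒≤ {f = index ∘ mem ∘ Inverse.from e}
  (λ {i} {j} eq → from-inj (inj
    (trans (lookup-index (mem (Inverse.from e i)))
    (trans (cong (List.lookup ys) eq) (sym (lookup-index (mem (Inverse.from e j))))))))
  where
  from-inj : ∀ {i j} → Inverse.from e i ≡ Inverse.from e j → i ≡ j
  from-inj eq = trans (sym (Inverse.strictlyInverseˡ e _))
    (trans (cong (Inverse.to e) eq) (Inverse.strictlyInverseˡ e _))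

-- `g` recovers `x` from `f p` whatever the proof `p`, so a repetition among the images would be a
-- repetition in `xs`. It turns lists of vertex sets with a property into lists of subgraphs.
reduce-unique : ∀ {A B : Set} {P : A → Set} (f : ∀ {x} → P x → B) (g : B → A) →
  (∀ {x} (p : P x) → g (f p) ≡ x) → ∀ {xs} → Unique xs → (ps : All P xs) → Unique (All.reduce f ps)
reduce-unique {A} {B} {P} f g gf u ps = Uniqueₚ.map⁻ {f = g} (subst Unique (sym (image ps)) u)
  where
  image : ∀ {xs} (ps : All P xs) → map g (All.reduce f ps) ≡ xs
  image [] = refl
  image (p ∷ ps) = cong₂ _∷_ (gf p) (image ps)

length-reduce : ∀ {A B : Set} {P : A → Set} (f : ∀ {x} → P x → B) {xs} (ps : All P xs) →
  length (All.reduce f ps) ≡ length xs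
length-reduce f [] = refl
length-reduce f (p ∷ ps) = cong suc (length-reduce f ps)

∈-reduce : ∀ {A B : Set} {P : A → Set} (f : ∀ {x} → P x → B) {xs} (ps : All P xs) {y} →
  y ∈ All.reduce f ps → ∃ λ x → x ∈ xs × Σ (P x) λ p → y ≡ f p
∈-reduce f (p ∷ ps) (here eq) = _ , here refl , p , eq
∈-reduce f (p ∷ ps) (there m) with ∈-reduce f ps m
... | x , x∈ , p′ , eq = x , there x∈ , p′ , eq

sum-mono : ∀ {A : Set} (f g : A → ℕ) (xs : List A) → (∀ {x} → x ∈ xs → f x ≤ g x) →
  sum (map f xs) ≤ sum (map g xs)
sum-mono f g [] le = z≤n
sum-mono f g (x ∷ xs) le = +-mono-≤ (le (here refl)) (sum-mono f g xs (le ∘ there))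

-- Termwise inequality without slack in the total leaves no slack in any term. This is how equality
-- of counts is turned into facts about single subtrees.
sum-tight : ∀ {A : Set} (f g : A → ℕ) (xs : List A) → (∀ {x} → x ∈ xs → f x ≤ g x) →
  sum (map g xs) ≤ sum (map f xs) → ∀ {x} → x ∈ xs → g x ≤ f x
sum-tight f g (y ∷ xs) le tot (here refl) = ℕₚ.+-cancelʳ-≤ (sum (map f xs)) (g y) (f y)
  (≤-trans (+-monoʳ-≤ (g y) (sum-mono f g xs (le ∘ there))) tot)
sum-tight f g (y ∷ xs) le tot (there x∈) = sum-tight f g xs (le ∘ there)
  (+-cancelˡ-≤ (f y) _ _ (≤-trans (+-monoˡ-≤ _ (le (here refl))) tot)) x∈

sum-const : ∀ {A : Set} (c : ℕ) (xs : List A) → sum (map (λ _ → c) xs) ≡ length xs * c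
sum-const c [] = refl
sum-const c (x ∷ xs) = cong (c +_) (sum-const c xs)

sum-map-+ : ∀ {A : Set} (f g : A → ℕ) (xs : List A) →
  sum (map (λ x → f x + g x) xs) ≡ sum (map f xs) + sum (map g xs)
sum-map-+ f g [] = refl
sum-map-+ f g (x ∷ xs) rewrite sum-map-+ f g xs =
  interchange (f x) (g x) (sum (map f xs)) (sum (map g xs))
  where
  open import Algebra.Properties.CommutativeSemigroup ℕₚ.+-commutativeSemigroup using (interchange)

does⁻ : ∀ {P : Set} (P? : Dec P) → does P? ≡ true → P
does⁻ (yes p) _ = p

does-no : ∀ {P : Set} (P? : Dec P) → does P? ≡ false → ¬ P
does-no (no ¬p) _ = ¬p

true≢false : ∀ {b} → b ≡ true → b ≡ false → ⊥
true≢false refl ()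

bool-ext : ∀ {a b} → (a ≡ true → b ≡ true) → (b ≡ true → a ≡ true) → a ≡ b
bool-ext {true}  {true}  f g = refl
bool-ext {true}  {false} f g = sym (f refl)
bool-ext {false} {true}  f g = g refl
bool-ext {false} {false} f g = refl

not-true : ∀ {b} → (b ≡ true → ⊥) → b ≡ false
not-true {true}  h = ⊥-elim (h refl)
not-true {false} h = refl

∧-true : ∀ {a b} → a ∧ b ≡ true → a ≡ true × b ≡ true
∧-true {true} {true} refl = refl , refl

∨-true : ∀ {a b} → a ∨ b ≡ true → a ≡ true ⊎ b ≡ true
∨-true {true} e = inj₁ refl
∨-true {false} e = inj₂ e

∨-false : ∀ {a b} → a ∨ b ≡ false → a ≡ false × b ≡ false
∨-false {false} {false} refl = refl , refl

vec-ext : ∀ {A : Set} {n} {xs ys : Vec A n} → (∀ i → lookup xs i ≡ lookup ys i) → xs ≡ ys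
vec-ext {xs = xs} {ys} e = trans (sym (tabulate∘lookup xs)) (trans (tabulate-cong e) (tabulate∘lookup ys))

least : (P : ℕ → Set) → (∀ m → Dec (P m)) → ∀ N → P N →
  ∃ λ m → P m × (∀ j → P j → m ≤ j)
least P P? zero p = 0 , p , λ _ _ → z≤n
least P P? (suc N) p with P? 0
... | yes p₀ = 0 , p₀ , λ _ _ → z≤n
... | no ¬p₀ with least (P ∘ suc) (P? ∘ suc) N p
...   | m , pm , min = suc m , pm , λ { zero p₀ → ⊥-elim (¬p₀ p₀) ; (suc j) pj → s≤s (min j pj) }

-- Subsets of Fin n as Boolean functions

elems : ∀ {n} → (Fin n → Bool) → List (Fin n)
elems {n} M = filter (λ i → M i Bool.≟ true) (allFin n)

cnt : ∀ {n} → (Fin n → Bool) → ℕ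
cnt {zero}  M = 0
cnt {suc n} M = (if M zero then 1 else 0) + cnt (M ∘ suc)

elems-unique : ∀ {n} (M : Fin n → Bool) → Unique (elems M)
elems-unique {n} M = Uniqueₚ.filter⁺ (λ i → M i Bool.≟ true) (Uniqueₚ.allFin⁺ n)

∈-elems⁺ : ∀ {n} {M : Fin n → Bool} {i} → M i ≡ true → i ∈ elems M
∈-elems⁺ {M = M} {i} e = ∈-filter⁺ (λ i → M i Bool.≟ true) (∈-allFin i) e

∈-elems⁻ : ∀ {n} {M : Fin n → Bool} {i} → i ∈ elems M → M i ≡ true
∈-elems⁻ {n} {M = M} m = proj₂ (∈-filter⁻ (λ i → M i Bool.≟ true) {xs = allFin n} m)

sum-indicator≡cnt : ∀ {n} (M : Fin n → Bool) →
  sum (map (λ i → if M i then 1 else 0) (allFin n)) ≡ cnt M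
sum-indicator≡cnt {n} M = trans (cong sum (map-tabulate {n = n} id (λ i → if M i then 1 else 0))) (go n M)
  where
  go : ∀ n (M : Fin n → Bool) → sum (tabulate (λ i → if M i then 1 else 0)) ≡ cnt M
  go zero M = refl
  go (suc n) M = cong ((if M zero then 1 else 0) +_) (go n (M ∘ suc))

length-elems : ∀ {n} (M : Fin n → Bool) → length (elems M) ≡ cnt M
length-elems {n} M = trans (go (allFin n)) (sum-indicator≡cnt M)
  where
  go : ∀ xs → length (filter (λ i → M i Bool.≟ true) xs) ≡ sum (map (λ i → if M i then 1 else 0) xs)
  go [] = refl
  go (x ∷ xs) with M x
  ... | true  = cong suc (go xs)
  ... | false = go xs

cnt-mono : ∀ {n} {M M′ : Fin n → Bool} → (∀ i → M i ≡ true → M′ i ≡ true) → cnt M ≤ cnt M′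
cnt-mono {M = M} {M′} imp rewrite sym (length-elems M) | sym (length-elems M′) =
  unique-⊆⇒length≤ (elems-unique M) (λ m → ∈-elems⁺ {M = M′} (imp _ (∈-elems⁻ {M = M} m)))

cnt-ext : ∀ {n} {M M′ : Fin n → Bool} → (∀ i → M i ≡ M′ i) → cnt M ≡ cnt M′
cnt-ext e = ≤-antisym (cnt-mono λ i p → trans (sym (e i)) p) (cnt-mono λ i p → trans (e i) p)

cnt-split : ∀ {n} (M S : Fin n → Bool) →
  cnt (λ i → M i ∧ S i) + cnt (λ i → M i ∧ not (S i)) ≡ cnt M
cnt-split {zero}  M S = refl
cnt-split {suc n} M S with M zero | S zero
... | true  | true  = cong suc (cnt-split (M ∘ suc) (S ∘ suc))
... | true  | false = trans (+-suc _ _) (cong suc (cnt-split (M ∘ suc) (S ∘ suc)))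
... | false | _     = cnt-split (M ∘ suc) (S ∘ suc)

cnt-complement : ∀ {n} (M : Fin n → Bool) → cnt M + cnt (not ∘ M) ≡ n
cnt-complement {zero}  M = refl
cnt-complement {suc n} M with M zero
... | true  = cong suc (cnt-complement (M ∘ suc))
... | false = trans (+-suc _ _) (cong suc (cnt-complement (M ∘ suc)))

cnt>0⇒∃ : ∀ {n} (M : Fin n → Bool) → 0 < cnt M → ∃ λ i → M i ≡ true
cnt>0⇒∃ {suc n} M p with M zero in eq
... | true  = zero , eq
... | false with cnt>0⇒∃ (M ∘ suc) p
...   | i , e = suc i , e

∃⇒cnt>0 : ∀ {n} (M : Fin n → Bool) i → M i ≡ true → 0 < cnt M
∃⇒cnt>0 M zero e rewrite e = s≤s z≤n
∃⇒cnt>0 M (suc i) e = ≤-trans (∃⇒cnt>0 (M ∘ suc) i e) (m≤n+m _ _)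

cnt≡1⇒unique : ∀ {n} (M : Fin n → Bool) → cnt M ≡ 1 → ∀ {i j} → M i ≡ true → M j ≡ true → i ≡ j
cnt≡1⇒unique M c {i} {j} p q with i ≟ j
... | yes e = e
... | no ne = ⊥-elim (<-irrefl refl (subst (2 ≤_) c (subst (2 ≤_) (length-elems M)
  (unique-⊆⇒length≤ {xs = i ∷ j ∷ []} ((ne ∷ []) ∷ [] ∷ [])
    λ { (here refl) → ∈-elems⁺ {M = M} p ; (there (here refl)) → ∈-elems⁺ {M = M} q }))))

cnt-inject≤ : ∀ {n} (M : Fin n → Bool) (f : Fin n → ℕ) (m : ℕ) →
  (∀ {i j} → M i ≡ true → M j ≡ true → f i ≡ f j → i ≡ j) →
  (∀ i → M i ≡ true → f i < m) → cnt M ≤ m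
cnt-inject≤ M f m inj lt = ≤-trans (≤-reflexive (sym (trans (length-map f (elems M)) (length-elems M))))
  (≤-trans (unique-⊆⇒length≤ (uniq (elems M) (elems-unique M) (∈-elems⁻ {M = M}))
    λ m∈ → case ∈-map⁻ f m∈ of λ { (i , i∈ , refl) → ∈-upTo⁺ (lt i (∈-elems⁻ {M = M} i∈)) })
    (≤-reflexive (length-upTo m)))
  where
  uniq : ∀ xs → Unique xs → (∀ {i} → i ∈ xs → M i ≡ true) → Unique (map f xs)
  uniq [] [] _ = []
  uniq (x ∷ xs) (x∉ ∷ u) mem =
    Allₚ.map⁺ (All.tabulate λ y∈ e → All.lookup x∉ y∈ (inj (mem (here refl)) (mem (there y∈)) e))
    ∷ uniq xs u (mem ∘ there)

cnt-surject≥ : ∀ {n} (M : Fin n → Bool) (f : Fin n → ℕ) (m : ℕ) →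
  (∀ q → q < m → ∃ λ i → M i ≡ true × f i ≡ q) → m ≤ cnt M
cnt-surject≥ M f m hit = ≤-trans (≤-reflexive (sym (length-upTo m)))
  (≤-trans (unique-⊆⇒length≤ {ys = map f (elems M)} (Uniqueₚ.upTo⁺ m)
      λ q∈ → case hit _ (∈-upTo⁻ q∈) of λ { (i , Mi , refl) → ∈-map⁺ f (∈-elems⁺ {M = M} Mi) })
    (≤-reflexive (trans (length-map f (elems M)) (length-elems M))))

cnt-punchIn : ∀ {n} (M : Fin (suc n) → Bool) j →
  cnt M ≡ (if M j then 1 else 0) + cnt (M ∘ punchIn j)
cnt-punchIn M zero = refl
cnt-punchIn {suc n} M (suc j) = trans (cong ((if M zero then 1 else 0) +_) (cnt-punchIn (M ∘ suc) j))
  (x∙yz≈y∙xz (if M zero then 1 else 0) (if M (suc j) then 1 else 0) _)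
  where open import Algebra.Properties.CommutativeSemigroup ℕₚ.+-commutativeSemigroup using (x∙yz≈y∙xz)

cnt≡0 : ∀ {n} {M : Fin n → Bool} → (∀ i → M i ≡ true → ⊥) → cnt M ≡ 0
cnt≡0 {zero} h = refl
cnt≡0 {suc n} {M} h rewrite not-true (h zero) = cnt≡0 {M = M ∘ suc} (h ∘ suc)

cnt-∨ : ∀ {n} (M M′ : Fin n → Bool) → cnt (λ i → M i ∨ M′ i) ≤ cnt M + cnt M′
cnt-∨ {zero} M M′ = z≤n
cnt-∨ {suc n} M M′ with M zero | M′ zero
... | true  | true  = s≤s (≤-trans (cnt-∨ (M ∘ suc) (M′ ∘ suc)) (+-monoʳ-≤ (cnt (M ∘ suc)) (n≤1+n _)))
... | true  | false = s≤s (cnt-∨ (M ∘ suc) (M′ ∘ suc))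
... | false | true  = ≤-trans (s≤s (cnt-∨ (M ∘ suc) (M′ ∘ suc))) (≤-reflexive (sym (+-suc _ _)))
... | false | false = cnt-∨ (M ∘ suc) (M′ ∘ suc)

-- Reachability and the finiteness of the set of connected subgraphs

module Reachability {n : ℕ} (R : Fin n → Fin n → Set) (R? : ∀ u v → Dec (R u v)) where

  -- Warshall: the list bounds the intermediate vertices.
  Via : List (Fin n) → Fin n → Fin n → Set
  Via [] u v = u ≡ v ⊎ R u v
  Via (w ∷ ws) u v = Via ws u v ⊎ (Via ws u w × Via ws w v)

  via? : ∀ ws u v → Dec (Via ws u v)
  via? [] u v = (u ≟ v) ⊎-dec R? u v
  via? (w ∷ ws) u v = via? ws u v ⊎-dec (via? ws u w ×-dec via? ws w v)

  via⇒star : ∀ ws {u v} → Via ws u v → Star R u v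
  via⇒star [] (inj₁ refl) = ε
  via⇒star [] (inj₂ r) = r ◅ ε
  via⇒star (w ∷ ws) (inj₁ p) = via⇒star ws p
  via⇒star (w ∷ ws) (inj₂ (p , q)) = via⇒star ws p ◅◅ via⇒star ws q

  via-lift : ∀ ws {u v} → Via [] u v → Via ws u v
  via-lift [] p = p
  via-lift (w ∷ ws) p = inj₁ (via-lift ws p)

  via-trans : ∀ ws {u x v} → x ∈ ws → Via ws u x → Via ws x v → Via ws u v
  via-trans (w ∷ ws) (here refl) p q = inj₂ (into p , out q)
    where
    -- A walk that ends or starts at `w` never needs `w` as an intermediate vertex: it can stop at
    -- the first visit, or start at the last.
    into : ∀ {u} → Via (w ∷ ws) u w → Via ws u w
    into (inj₁ p) = p
    into (inj₂ (p , _)) = p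
    out : ∀ {v} → Via (w ∷ ws) w v → Via ws w v
    out (inj₁ q) = q
    out (inj₂ (_ , q)) = q
  via-trans (w ∷ ws) (there x∈) (inj₁ p) (inj₁ q) = inj₁ (via-trans ws x∈ p q)
  via-trans (w ∷ ws) (there x∈) (inj₁ p) (inj₂ (q , q′)) = inj₂ (via-trans ws x∈ p q , q′)
  via-trans (w ∷ ws) (there x∈) (inj₂ (p , p′)) (inj₁ q) = inj₂ (p , via-trans ws x∈ p′ q)
  -- Both walks visit `w`, so the closed walk from `w` through `x` back to `w` is dropped.
  via-trans (w ∷ ws) (there x∈) (inj₂ (p , _)) (inj₂ (_ , q)) = inj₂ (p , q)

  star⇒via : ∀ {u v} → Star R u v → Via (allFin n) u v
  star⇒via ε = via-lift (allFin n) (inj₁ refl)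
  star⇒via (_◅_ {j = x} r s) =
    via-trans (allFin n) (∈-allFin x) (via-lift (allFin n) (inj₂ r)) (star⇒via s)

  star? : ∀ u v → Dec (Star R u v)
  star? u v = map′ (via⇒star (allFin n)) star⇒via (via? (allFin n) u v)

vectors : ∀ {A : Set} → List A → ∀ n → List (Vec A n)
vectors xs zero = [] ∷ []
vectors xs (suc n) = cartesianProductWith _∷_ xs (vectors xs n)

vectors-unique : ∀ {A : Set} {xs : List A} → Unique xs → ∀ n → Unique (vectors xs n)
vectors-unique u zero = [] ∷ []
vectors-unique u (suc n) = Uniqueₚ.cartesianProductWith⁺ _∷_ Vecₚ.∷-injective u (vectors-unique u n)

∈-vectors : ∀ {A : Set} {xs : List A} → (∀ x → x ∈ xs) → ∀ {n} (v : Vec A n) → v ∈ vectors xs n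
∈-vectors all [] = here refl
∈-vectors all (x ∷ v) = ∈-cartesianProductWith⁺ _∷_ (all x) (∈-vectors all v)

record IsConnSub {n} (G : Graph n) (V : Vec Bool n) (E : Vec (Vec Bool n) n) : Set where
  constructor isConnSub
  field
    nonempty  : ∃ λ v → lookup V v ≡ true
    symmetric : ∀ i j → lookup (lookup E i) j ≡ lookup (lookup E j) i
    subset    : ∀ i j → lookup (lookup E i) j ≡ true →
                (adj G i j ≡ true) × (lookup V i ≡ true) × (lookup V j ≡ true)
    connected : ∀ u v → lookup V u ≡ true → lookup V v ≡ true →
                Star (λ i j → lookup (lookup E i) j ≡ true) u v

isConnSub? : ∀ {n} (G : Graph n) V E → Dec (IsConnSub G V E)
isConnSub? G V E = map′ (λ { (a , b , c , d) → isConnSub a b c d })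
                        (λ { (isConnSub a b c d) → a , b , c , d })
  (any? (λ v → lookup V v Bool.≟ true)
   ×-dec all? (λ i → all? λ j → lookup (lookup E i) j Bool.≟ lookup (lookup E j) i)
   ×-dec all? (λ i → all? λ j → (lookup (lookup E i) j Bool.≟ true) →-dec
           ((adj G i j Bool.≟ true) ×-dec (lookup V i Bool.≟ true) ×-dec (lookup V j Bool.≟ true)))
   ×-dec all? (λ u → all? λ v → (lookup V u Bool.≟ true) →-dec ((lookup V v Bool.≟ true) →-dec
           Reachability.star? (λ i j → lookup (lookup E i) j ≡ true)
                              (λ i j → lookup (lookup E i) j Bool.≟ true) u v)))

connSub : ∀ {n} {G : Graph n} {V E} → IsConnSub G V E → ConnSub G
connSub {V = V} {E} p = record
  { V = V ; E = E
  ; nonempty = IsConnSub.nonempty p ; symmetric = IsConnSub.symmetric p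
  ; subset = IsConnSub.subset p ; connected = IsConnSub.connected p }

-- The proofs inside `ConnSub` are irrelevant and cannot be inspected; since the property is
-- decidable, a usable proof is recomputed from `V` and `E`.
valid : ∀ {n} {G : Graph n} (C : ConnSub G) → IsConnSub G (ConnSub.V C) (ConnSub.E C)
valid {G = G} record { V = V ; E = E ; nonempty = a ; symmetric = b ; subset = c ; connected = d } =
  recompute (isConnSub? G V E) (isConnSub a b c d)

connSub-≡ : ∀ {n} {G : Graph n} {C D : ConnSub G} →
  ConnSub.V C ≡ ConnSub.V D → ConnSub.E C ≡ ConnSub.E D → C ≡ D
connSub-≡ refl refl = refl

-- All pairs of a Boolean vector and a Boolean matrix are listed and filtered by the decided
-- predicate.
coreIndex : ∀ {n} (G : Graph n) → ∃ (CoreIndex G)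
coreIndex {n} G = length subs , enumeration↔
  (reduce-unique mk (λ C → ConnSub.V C , ConnSub.E C) (λ _ → refl) (Uniqueₚ.filter⁺ ok? pairs-unique) oks)
  complete
  where
  bools : List Bool
  bools = true ∷ false ∷ []
  bools-unique : Unique bools
  bools-unique = ((λ ()) ∷ []) ∷ [] ∷ []
  ∈-bools : ∀ b → b ∈ bools
  ∈-bools true = here refl
  ∈-bools false = there (here refl)
  pairs = cartesianProductWith _,_ (vectors bools n) (vectors (vectors bools n) n)
  pairs-unique : Unique pairs
  pairs-unique = Uniqueₚ.cartesianProduct⁺ (vectors-unique bools-unique n)
    (vectors-unique (vectors-unique bools-unique n) n)
  Ok : Vec Bool n × Vec (Vec Bool n) n → Set
  Ok (V , E) = IsConnSub G V E
  ok? : ∀ VE → Dec (Ok VE)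
  ok? (V , E) = isConnSub? G V E
  mk : ∀ {VE} → Ok VE → ConnSub G
  mk p = connSub p
  oks : All Ok (filter ok? pairs)
  oks = Allₚ.all-filter ok? pairs
  subs = All.reduce mk oks
  -- The listed subgraph carries another validity proof than `C`; by irrelevance, equal `V` and `E`
  -- already make them equal.
  hit : ∀ {xs} (ps : All Ok xs) {V E} → (V , E) ∈ xs → (C : ConnSub G) →
    ConnSub.V C ≡ V → ConnSub.E C ≡ E → C ∈ All.reduce mk ps
  hit (p ∷ ps) (here refl) C refl refl = here refl
  hit (p ∷ ps) (there m) C e e′ = there (hit ps m C e e′)
  complete : ∀ C → C ∈ subs
  complete C = hit oks (∈-filter⁺ ok? {xs = pairs}
    (∈-cartesianProductWith⁺ _,_ (∈-vectors ∈-bools (ConnSub.V C))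
      (∈-vectors (∈-vectors ∈-bools) (ConnSub.E C)))
    (valid C)) C refl refl

-- Invariance of the core index under isomorphism

coreIndex-≅ : ∀ {n m} {G : Graph n} {H : Graph m} {a b} → G ≅ H → CoreIndex G a → CoreIndex H b → a ≤ b
coreIndex-≅ {n} {m} {G} {H} (π , adj≡) eG eH =
  injective⇒≤ {f = Inverse.to eH ∘ transport ∘ Inverse.from eG} λ eq →
    injective-inverse eG (transport-injective (injective-to eH eq))
  where
  to = Inverse.to π
  from = Inverse.from π
  from-to : ∀ i → from (to i) ≡ i
  from-to = Inverse.strictlyInverseʳ π
  to-from : ∀ i → to (from i) ≡ i
  to-from = Inverse.strictlyInverseˡ π
  injective-to : ∀ {A B : Set} (e : A ↔ B) {x y} → Inverse.to e x ≡ Inverse.to e y → x ≡ y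
  injective-to e eq = trans (sym (Inverse.strictlyInverseʳ e _))
    (trans (cong (Inverse.from e) eq) (Inverse.strictlyInverseʳ e _))
  injective-inverse : ∀ {A B : Set} (e : A ↔ B) {x y} → Inverse.from e x ≡ Inverse.from e y → x ≡ y
  injective-inverse e eq = trans (sym (Inverse.strictlyInverseˡ e _))
    (trans (cong (Inverse.to e) eq) (Inverse.strictlyInverseˡ e _))
  tabV : Vec Bool n → Vec Bool m
  tabV V = Vec.tabulate (lookup V ∘ from)
  tabE : Vec (Vec Bool n) n → Vec (Vec Bool m) m
  tabE E = Vec.tabulate λ i → Vec.tabulate λ j → lookup (lookup E (from i)) (from j)
  lookV : ∀ V i → lookup (tabV V) i ≡ lookup V (from i)
  lookV V = lookup∘tabulate _
  lookE : ∀ E i j → lookup (lookup (tabE E) i) j ≡ lookup (lookup E (from i)) (from j)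
  lookE E i j rewrite lookup∘tabulate (λ i → Vec.tabulate λ j → lookup (lookup E (from i)) (from j)) i =
    lookup∘tabulate _ j
  lookE′ : ∀ E i j → lookup (lookup (tabE E) (to i)) (to j) ≡ lookup (lookup E i) j
  lookE′ E i j = trans (lookE E (to i) (to j))
    (cong₂ (λ x y → lookup (lookup E x) y) (from-to i) (from-to j))
  transport-valid : ∀ {V E} → IsConnSub G V E → IsConnSub H (tabV V) (tabE E)
  transport-valid {V} {E} (isConnSub ne sy su co) = isConnSub
    (to (proj₁ ne) , trans (lookV V _) (trans (cong (lookup V) (from-to _)) (proj₂ ne)))
    (λ i j → trans (lookE E i j) (trans (sy _ _) (sym (lookE E j i))))
    (λ i j e → let a , b , c = su (from i) (from j) (trans (sym (lookE E i j)) e) in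
      trans (sym (trans (adj≡ (from i) (from j)) (cong₂ (adj H) (to-from i) (to-from j)))) a ,
      trans (lookV V i) b , trans (lookV V j) c)
    (λ u v p q → cong₂-star (to-from u) (to-from v)
      (gmap to (λ {i} {j} e → trans (lookE′ E i j) e)
        (co (from u) (from v) (trans (sym (lookV V u)) p) (trans (sym (lookV V v)) q))))
    where
    cong₂-star : ∀ {u u′ v v′} → u ≡ u′ → v ≡ v′ →
      Star (λ i j → lookup (lookup (tabE E) i) j ≡ true) u v →
      Star (λ i j → lookup (lookup (tabE E) i) j ≡ true) u′ v′
    cong₂-star refl refl s = s
  transport : ConnSub G → ConnSub H
  transport C = connSub (transport-valid (valid C))
  transport-injective : ∀ {C D} → transport C ≡ transport D → C ≡ D
  transport-injective {C} {D} eq = connSub-≡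
    (vec-ext λ i → trans (sym (trans (lookV (ConnSub.V C) (to i)) (cong (lookup (ConnSub.V C)) (from-to i))))
      (trans (cong (λ X → lookup (ConnSub.V X) (to i)) eq)
        (trans (lookV (ConnSub.V D) (to i)) (cong (lookup (ConnSub.V D)) (from-to i)))))
    (vec-ext λ i → vec-ext λ j → trans (sym (lookE′ (ConnSub.E C) i j))
      (trans (cong (λ X → lookup (lookup (ConnSub.E X) (to i)) (to j)) eq) (lookE′ (ConnSub.E D) i j)))

≅-sym : ∀ {n m} {G : Graph n} {H : Graph m} → G ≅ H → H ≅ G
≅-sym {H = H} (π , adj≡) = ↔-sym π , λ i j → trans
  (sym (cong₂ (adj H) (Inverse.strictlyInverseˡ π i) (Inverse.strictlyInverseˡ π j)))
  (sym (adj≡ (Inverse.from π i) (Inverse.from π j)))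
  where open import Function.Properties.Inverse using (↔-sym)

-- Vertex sets that agree with a given set off L and lie below it on L

heads : Bool → Bool → List Bool
heads b true  = true ∷ false ∷ []
heads b false = b ∷ []

free : ∀ {n} → (Fin n → Bool) → (Fin n → Bool) → List (Vec Bool n)
free {zero}  S M = [] ∷ []
free {suc n} S M = cartesianProductWith _∷_ (heads (S zero) (M zero)) (free (S ∘ suc) (M ∘ suc))

length-cartesian : ∀ {A B C : Set} (f : A → B → C) xs ys →
  length (cartesianProductWith f xs ys) ≡ length xs * length ys
length-cartesian f [] ys = refl
length-cartesian f (x ∷ xs) ys = trans (length-++ (map (f x) ys))
  (cong₂ _+_ (length-map (f x) ys) (length-cartesian f xs ys))

length-free : ∀ {n} (S M : Fin n → Bool) → length (free S M) ≡ 2 ^ cnt M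
length-free {zero}  S M = refl
length-free {suc n} S M = trans (length-cartesian _∷_ (heads (S zero) (M zero)) _) step
  where
  step : length (heads (S zero) (M zero)) * length (free (S ∘ suc) (M ∘ suc)) ≡ 2 ^ cnt M
  step with M zero
  ... | true  = cong (2 *_) (length-free (S ∘ suc) (M ∘ suc))
  ... | false = trans (+-identityʳ _) (length-free (S ∘ suc) (M ∘ suc))

free-unique : ∀ {n} (S M : Fin n → Bool) → Unique (free S M)
free-unique {zero}  S M = [] ∷ []
free-unique {suc n} S M = Uniqueₚ.cartesianProductWith⁺ _∷_ Vecₚ.∷-injective
  (heads-unique (M zero)) (free-unique (S ∘ suc) (M ∘ suc))
  where
  heads-unique : ∀ m → Unique (heads (S zero) m)
  heads-unique true  = ((λ ()) ∷ []) ∷ [] ∷ []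
  heads-unique false = [] ∷ []

∈-free⁺ : ∀ {n} (S M : Fin n → Bool) (V : Vec Bool n) →
  (∀ i → M i ≡ false → lookup V i ≡ S i) → V ∈ free S M
∈-free⁺ S M [] h = here refl
∈-free⁺ S M (b ∷ V) h = ∈-cartesianProductWith⁺ _∷_ (head (M zero) (h zero)) (∈-free⁺ _ _ V (h ∘ suc))
  where
  head : ∀ {b} m → (m ≡ false → b ≡ S zero) → b ∈ heads (S zero) m
  head false h = here (h refl)
  head {true} true h = here refl
  head {false} true h = there (here refl)

∈-free⁻ : ∀ {n} (S M : Fin n → Bool) (V : Vec Bool n) → V ∈ free S M →
  ∀ i → M i ≡ false → lookup V i ≡ S i
∈-free⁻ {suc n} S M V V∈ i e
  with ∈-cartesianProductWith⁻ _∷_ (heads (S zero) (M zero)) (free (S ∘ suc) (M ∘ suc)) V∈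
∈-free⁻ {suc n} S M V V∈ zero e | b , W , b∈ , W∈ , refl with M zero | b∈
... | false | here eq = eq
∈-free⁻ {suc n} S M V V∈ (suc i) e | b , W , b∈ , W∈ , refl = ∈-free⁻ _ _ W W∈ i e

-- In use, `S` is a subtree together with all pendant vertices attached to it, and a member of the
-- family discards any of these pendant vertices.
fam : ∀ {n} → (Fin n → Bool) → (Fin n → Bool) → List (Vec Bool n)
fam L S = free S (λ i → L i ∧ S i)

∧-falseˡ : ∀ {a b} → a ≡ false → a ∧ b ≡ false
∧-falseˡ refl = refl

∈-fam⁺ : ∀ {n} (L S : Fin n → Bool) (V : Vec Bool n) →
  (∀ i → L i ≡ false → lookup V i ≡ S i) → (∀ i → lookup V i ≡ true → S i ≡ true) → V ∈ fam L S
∈-fam⁺ L S V off on = ∈-free⁺ S _ V λ i e → agree i e (off i) (on i)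
  where
  agree : ∀ i → L i ∧ S i ≡ false → (L i ≡ false → lookup V i ≡ S i) →
    (lookup V i ≡ true → S i ≡ true) → lookup V i ≡ S i
  agree i e off on with L i | S i | lookup V i
  ... | false | _     | _     = off refl
  ... | true  | false | false = refl
  ... | true  | false | true  = sym (on refl)

fam-off : ∀ {n} (L S : Fin n → Bool) (V : Vec Bool n) → V ∈ fam L S →
  ∀ i → L i ≡ false → lookup V i ≡ S i
fam-off L S V V∈ i e = ∈-free⁻ S _ V V∈ i (∧-falseˡ e)

fam-⊆ : ∀ {n} (L S : Fin n → Bool) (V : Vec Bool n) → V ∈ fam L S →
  ∀ i → lookup V i ≡ true → S i ≡ true
fam-⊆ L S V V∈ i e with S i in eq
... | true = refl
... | false = trans (sym (trans (∈-free⁻ S _ V V∈ i (trans (cong (L i ∧_) eq) (Boolₚ.∧-zeroʳ (L i)))) eq)) e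

-- Unordered pairs of cut edges, and the common list of vertex sets

pairs : ∀ {A : Set} → List A → List (A × A)
pairs [] = []
pairs (x ∷ xs) = map (x ,_) xs ++ pairs xs

-- The binomial coefficient C(m,2).
triangle : ℕ → ℕ
triangle zero = 0
triangle (suc m) = m + triangle m

length-pairs : ∀ {A : Set} (xs : List A) → length (pairs xs) ≡ triangle (length xs)
length-pairs [] = refl
length-pairs (x ∷ xs) = trans (length-++ (map (x ,_) xs)) (cong₂ _+_ (length-map (x ,_) xs) (length-pairs xs))

∈-pairs⁻ : ∀ {A : Set} {xs : List A} → Unique xs → ∀ {u v} → (u , v) ∈ pairs xs →
  u ∈ xs × v ∈ xs × u ≢ v
∈-pairs⁻ {xs = x ∷ xs} (x∉ ∷ un) m with ∈-++⁻ (map (x ,_) xs) m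
... | inj₁ p with ∈-map⁻ (x ,_) p
...   | v , v∈ , refl = here refl , there v∈ , All.lookup x∉ v∈
∈-pairs⁻ {xs = x ∷ xs} (x∉ ∷ un) m | inj₂ p with ∈-pairs⁻ un p
...   | u∈ , v∈ , ne = there u∈ , there v∈ , ne

∈-pairs⁺ : ∀ {A : Set} {xs : List A} {u v} → u ∈ xs → v ∈ xs → u ≢ v →
  (u , v) ∈ pairs xs ⊎ (v , u) ∈ pairs xs
∈-pairs⁺ (here refl) (here refl) ne = ⊥-elim (ne refl)
∈-pairs⁺ (here refl) (there v∈) ne = inj₁ (∈-++⁺ˡ (∈-map⁺ _ v∈))
∈-pairs⁺ (there u∈) (here refl) ne = inj₂ (∈-++⁺ˡ (∈-map⁺ _ u∈))
∈-pairs⁺ {xs = x ∷ xs} (there u∈) (there v∈) ne =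
  Sum.map (∈-++⁺ʳ (map (x ,_) xs)) (∈-++⁺ʳ (map (x ,_) xs)) (∈-pairs⁺ u∈ v∈ ne)

single : ∀ {n} → Fin n → Vec Bool n
single x = Vec.tabulate (λ i → does (i ≟ x))

single-self : ∀ {n} (x : Fin n) → lookup (single x) x ≡ true
single-self x = trans (lookup∘tabulate _ x) (≟-self x)
  where
  ≟-self : ∀ {n} (x : Fin n) → does (x ≟ x) ≡ true
  ≟-self x with x ≟ x
  ... | yes _ = refl
  ... | no ne = ⊥-elim (ne refl)

single-only : ∀ {n} (x i : Fin n) → lookup (single x) i ≡ true → i ≡ x
single-only x i e with i ≟ x | trans (sym (lookup∘tabulate (λ i → does (i ≟ x)) i)) e
... | yes p | _ = p

-- An index stands for an edge to be removed: `A x` and `B x` are the two sides, `mid` is the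
-- component between two removed edges. The scheme is used with the edges of a path for the upper
-- bound and with those of a spanning tree for the lower bound.
module Scheme {n : ℕ} (L : Fin n → Bool) {Ix : Set} (A B : Ix → Fin n → Bool)
  (mid : Ix × Ix → Fin n → Bool) (ixs : List Ix) where

  shapes : List (Fin n → Bool)
  shapes = (λ _ → true) ∷ map A ixs ++ map B ixs ++ map mid (pairs ixs)

  -- Single pendant vertices are listed apart, because every shape contains a non-pendant vertex and
  -- keeps it throughout its family.
  codes : List (Vec Bool n)
  codes = map single (elems L) ++ concatMap (fam L) shapes

  weight : (Fin n → Bool) → ℕ
  weight S = 2 ^ cnt (λ i → L i ∧ S i)

  length-codes : length codes ≡ cnt L + (2 ^ cnt L + (sum (map (weight ∘ A) ixs) +
    (sum (map (weight ∘ B) ixs) + sum (map (weight ∘ mid) (pairs ixs)))))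
  length-codes = trans (length-++ (map single (elems L))) (cong₂ _+_
    (trans (length-map single (elems L)) (length-elems L))
    (trans (length-concatMap shapes) (cong₂ _+_
      (trans (length-free (λ _ → true) (λ i → L i ∧ true)) (cong (2 ^_) (cnt-ext λ i → Boolₚ.∧-identityʳ (L i))))
      (trans (cong sum (map-++ _ (map A ixs) _)) (trans (sum-++ (map _ (map A ixs)) _)
        (cong₂ _+_ (part A ixs)
          (trans (cong sum (map-++ _ (map B ixs) _)) (trans (sum-++ (map _ (map B ixs)) _)
            (cong₂ _+_ (part B ixs) (part mid (pairs ixs)))))))))))
    where
    length-concatMap : ∀ Ss → length (concatMap (fam L) Ss) ≡ sum (map (length ∘ fam L) Ss)
    length-concatMap [] = refl
    length-concatMap (S ∷ Ss) = trans (length-++ (fam L S)) (cong (length (fam L S) +_) (length-concatMap Ss))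
    part : ∀ {J : Set} (F : J → Fin n → Bool) js →
      sum (map (length ∘ fam L) (map F js)) ≡ sum (map (weight ∘ F) js)
    part F [] = refl
    part F (j ∷ js) = cong₂ _+_ (length-free (F j) (λ i → L i ∧ F j i)) (part F js)

  ∈-shapes-A : ∀ {x} → x ∈ ixs → A x ∈ shapes
  ∈-shapes-A m = there (∈-++⁺ˡ (∈-map⁺ A m))

  ∈-shapes-B : ∀ {x} → x ∈ ixs → B x ∈ shapes
  ∈-shapes-B m = there (∈-++⁺ʳ (map A ixs) (∈-++⁺ˡ (∈-map⁺ B m)))

  ∈-shapes-mid : ∀ {x} → x ∈ pairs ixs → mid x ∈ shapes
  ∈-shapes-mid m = there (∈-++⁺ʳ (map A ixs) (∈-++⁺ʳ (map B ixs) (∈-map⁺ mid m)))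

  ∈-shapes⁻ : ∀ {S} → S ∈ shapes →
    S ≡ (λ _ → true) ⊎ (∃ λ x → x ∈ ixs × (S ≡ A x ⊎ S ≡ B x)) ⊎ ∃ λ x → x ∈ pairs ixs × S ≡ mid x
  ∈-shapes⁻ (here refl) = inj₁ refl
  ∈-shapes⁻ (there m) with ∈-++⁻ (map A ixs) m
  ... | inj₁ p with ∈-map⁻ A p
  ...   | x , x∈ , e = inj₂ (inj₁ (x , x∈ , inj₁ e))
  ∈-shapes⁻ (there m) | inj₂ q with ∈-++⁻ (map B ixs) q
  ... | inj₁ p with ∈-map⁻ B p
  ...   | x , x∈ , e = inj₂ (inj₁ (x , x∈ , inj₂ e))
  ∈-shapes⁻ (there m) | inj₂ q | inj₂ p with ∈-map⁻ mid p
  ...   | x , x∈ , e = inj₂ (inj₂ (x , x∈ , e))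

  ∈-codes-single : ∀ {x} → L x ≡ true → single x ∈ codes
  ∈-codes-single e = ∈-++⁺ˡ (∈-map⁺ single (∈-elems⁺ {M = L} e))

  ∈-codes-fam : ∀ {S V} → S ∈ shapes → V ∈ fam L S → V ∈ codes
  ∈-codes-fam S∈ V∈ = ∈-++⁺ʳ (map single (elems L)) (∈-concat⁺′ V∈ (∈-map⁺ (fam L) S∈))

  ∈-codes⁻ : ∀ {V} → V ∈ codes →
    (∃ λ x → L x ≡ true × V ≡ single x) ⊎ (∃ λ S → S ∈ shapes × V ∈ fam L S)
  ∈-codes⁻ m with ∈-++⁻ (map single (elems L)) m
  ... | inj₁ p with ∈-map⁻ single p
  ...   | x , x∈ , e = inj₁ (x , ∈-elems⁻ {M = L} x∈ , e)
  ∈-codes⁻ m | inj₂ q with ∈-concat⁻′ (map (fam L) shapes) q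
  ... | Vs , V∈ , Vs∈ with ∈-map⁻ (fam L) Vs∈
  ...   | S , S∈ , refl = inj₂ (S , S∈ , V∈)

  -- A member of `fam L S` agrees with `S` off `L`. Shapes that differ there thus have disjoint
  -- families, and a shape that meets the complement of `L` yields no single pendant vertex.
  codes-unique : (∀ {S} → S ∈ shapes → ∃ λ i → L i ≡ false × S i ≡ true) →
    AllPairs (λ S S′ → ∃ λ i → L i ≡ false × S i ≢ S′ i) shapes → Unique codes
  codes-unique inner diff = Uniqueₚ.++⁺
    (Uniqueₚ.map⁺ (λ {x} {y} e → single-only y x (trans (cong (λ V → lookup V x) (sym e)) (single-self x)))
      (elems-unique L))
    (Uniqueₚ.concat⁺ (Allₚ.map⁺ (All.tabulate λ {S} _ → free-unique S _))
      (AllPairsₚ.map⁺ (AllPairs.map disj diff)))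
    λ { (p , q) → apart p q }
    where
    disj : ∀ {S S′} → (∃ λ i → L i ≡ false × S i ≢ S′ i) → Disjoint (fam L S) (fam L S′)
    disj {S} {S′} (i , Li , ne) {V} (V∈ , V∈′) =
      ne (trans (sym (fam-off L S V V∈ i Li)) (fam-off L S′ V V∈′ i Li))
    apart : ∀ {V} → V ∈ map single (elems L) → V ∈ concatMap (fam L) shapes → ⊥
    apart {V} p q with ∈-map⁻ single p | ∈-concat⁻′ (map (fam L) shapes) q
    ... | x , x∈ , refl | Vs , V∈ , Vs∈ with ∈-map⁻ (fam L) Vs∈
    ...   | S , S∈ , refl with inner S∈
    ...     | i , Li , Si with single-only x i (trans (fam-off L S (single x) V∈ i Li) Si)
    ...       | refl with trans (sym Li) (∈-elems⁻ {M = L} x∈)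
    ...         | ()

-- Balancing exponents

m+n≤m*n : ∀ {m n} → 2 ≤ m → 2 ≤ n → m + n ≤ m * n
m+n≤m*n {m} {n} 2≤m 2≤n with ≤-total m n
... | inj₁ m≤n = ≤-trans (+-monoˡ-≤ n m≤n) (≤-trans (≤-reflexive (cong (n +_) (sym (+-identityʳ n))))
  (ℕₚ.*-monoˡ-≤ n 2≤m))
... | inj₂ n≤m = ≤-trans (+-monoʳ-≤ m n≤m) (≤-trans (≤-reflexive (trans (cong (m +_) (sym (+-identityʳ m))) (ℕₚ.*-comm 2 m)))
  (*-monoʳ-≤ m 2≤n))

2≤2^suc : ∀ m → 2 ≤ 2 ^ suc m
2≤2^suc m = *-monoʳ-≤ 2 (m^n>0 2 m)

2^s+2^t<1+2^[s+t] : ∀ s t → 2 ^ suc s + 2 ^ suc t < 1 + 2 ^ (suc s + suc t)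
2^s+2^t<1+2^[s+t] s t rewrite ^-distribˡ-+-* 2 (suc s) (suc t) =
  s≤s (m+n≤m*n (2≤2^suc s) (2≤2^suc t))

2^s+2^t≤1+2^[s+t] : ∀ s t → 2 ^ s + 2 ^ t ≤ 1 + 2 ^ (s + t)
2^s+2^t≤1+2^[s+t] zero t = ≤-refl
2^s+2^t≤1+2^[s+t] (suc s) zero rewrite +-identityʳ s = ≤-reflexive (+-comm (2 ^ suc s) 1)
2^s+2^t≤1+2^[s+t] (suc s) (suc t) = <⇒≤ (2^s+2^t<1+2^[s+t] s t)

Balanced : ℕ → ℕ → ℕ → Set
Balanced k x y = (x ≡ ⌊ k /2⌋ × y ≡ ⌈ k /2⌉) ⊎ (x ≡ ⌈ k /2⌉ × y ≡ ⌊ k /2⌋)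

halves : ℕ → ℕ
halves k = 2 ^ ⌊ k /2⌋ + 2 ^ ⌈ k /2⌉

-- Lowering both exponents by one halves both sides, so everything reduces to one exponent being
-- zero, where the claim is `2^s+2^t≤1+2^[s+t]` for the two halves of the other.
halves≤ : ∀ x y → halves (x + y) ≤ 2 ^ x + 2 ^ y
halves≤ zero y = ≤-trans (2^s+2^t≤1+2^[s+t] ⌊ y /2⌋ ⌈ y /2⌉)
  (≤-reflexive (cong (λ z → 1 + 2 ^ z) (⌊n/2⌋+⌈n/2⌉≡n y)))
halves≤ (suc x) zero rewrite +-identityʳ x = ≤-trans (halves≤ zero (suc x)) (≤-reflexive (+-comm 1 _))
halves≤ (suc x) (suc y) rewrite +-suc x y
  | sym (ℕₚ.*-distribˡ-+ 2 (2 ^ ⌊ x + y /2⌋) (2 ^ ⌈ x + y /2⌉)) | sym (ℕₚ.*-distribˡ-+ 2 (2 ^ x) (2 ^ y)) =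
  *-monoʳ-≤ 2 (halves≤ x y)

halves-tight : ∀ x y → 2 ^ x + 2 ^ y ≤ halves (x + y) → Balanced (x + y) x y
halves-tight zero y le with ⌊ y /2⌋ | ⌈ y /2⌉ | ⌊n/2⌋+⌈n/2⌉≡n y | ℕₚ.⌊n/2⌋≤⌈n/2⌉ y
-- A positive floor with a zero ceiling is excluded by `⌊n/2⌋≤⌈n/2⌉`. If both halves are positive,
-- the strict inequality contradicts `le`.
... | zero  | t     | e | _ = inj₁ (refl , sym e)
... | suc s | suc t | refl | _ = ⊥-elim (<⇒≱ (2^s+2^t<1+2^[s+t] s t) le)
halves-tight (suc x) zero le rewrite +-identityʳ x
  with halves-tight zero (suc x) (≤-trans (≤-reflexive (+-comm 1 _)) le)
... | inj₁ (p , q) = inj₂ (q , p)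
... | inj₂ (p , q) = inj₁ (q , p)
halves-tight (suc x) (suc y) le rewrite +-suc x y
  with halves-tight x y (ℕₚ.*-cancelˡ-≤ 2 (≤-trans (≤-reflexive (ℕₚ.*-distribˡ-+ 2 (2 ^ x) (2 ^ y)))
    (≤-trans le (≤-reflexive (sym (ℕₚ.*-distribˡ-+ 2 (2 ^ ⌊ x + y /2⌋) (2 ^ ⌈ x + y /2⌉)))))))
... | inj₁ (p , q) = inj₁ (cong suc p , cong suc q)
... | inj₂ (p , q) = inj₂ (cong suc p , cong suc q)

-- Here `m` is d - 1, the number of edges joining non-pendant vertices in the extremal tree.
bound : ℕ → ℕ → ℕ
bound k m = k + (2 ^ k + (m * halves k + triangle m))

-- Graphs whose adjacency is consecutiveness of levels

Consecutive : ℕ → ℕ → Set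
Consecutive x y = suc x ≡ y ⊎ suc y ≡ x

-- Coordinates for T(a,b,d): levels 1 to `d` are the path, levels 0 and `suc d` its pendant
-- vertices. Upper bounds on level sizes are enough: the count is monotone in them, and for an
-- isomorphism equal numbers of vertices make up the rest.
record Levelled {n} (G : Graph n) (d a b : ℕ) : Set where
  field
    pos     : Fin n → ℕ
    pos≤    : ∀ i → pos i ≤ suc d
    adj⇒    : ∀ {i j} → adj G i j ≡ true → Consecutive (pos i) (pos j)
    adj⇐    : ∀ {i j} → Consecutive (pos i) (pos j) → adj G i j ≡ true
    pos-inj : ∀ {i j} → 1 ≤ pos i → pos i ≤ d → pos i ≡ pos j → i ≡ j
    low≤    : cnt (λ i → does (pos i ℕ.≟ 0)) ≤ a
    high≤   : cnt (λ i → does (pos i ℕ.≟ suc d)) ≤ b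

-- Upper bound for the core index of a levelled graph

module LevelledBound {n m a b} {G : Graph n} (lev : Levelled G (suc m) a b) where
  open Levelled lev

  d : ℕ
  d = suc m

  L : Fin n → Bool
  L i = does (pos i ℕ.≟ 0) ∨ does (pos i ℕ.≟ suc d)

  L-false : ∀ {i} → L i ≡ false → 1 ≤ pos i × pos i ≤ d
  L-false {i} e with ∨-false {does (pos i ℕ.≟ 0)} e
  ... | e₀ , e₁ = ℕₚ.n≢0⇒n>0 (does-no (pos i ℕ.≟ 0) e₀) ,
    ≤-pred (≤∧≢⇒< (pos≤ i) (does-no (pos i ℕ.≟ suc d) e₁))

  L-true⁺ : ∀ {i} → pos i ≡ 0 ⊎ pos i ≡ suc d → L i ≡ true
  L-true⁺ {i} (inj₁ e) rewrite e = refl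
  L-true⁺ {i} (inj₂ e) rewrite dec-true (pos i ℕ.≟ suc d) e = Boolₚ.∨-zeroʳ _

  L-true⁻ : ∀ {i} → L i ≡ true → pos i ≡ 0 ⊎ pos i ≡ suc d
  L-true⁻ {i} e = Sum.map (does⁻ (pos i ℕ.≟ 0)) (does⁻ (pos i ℕ.≟ suc d)) (∨-true e)

  -- The index `t`, below `m`, is the path edge between levels `t + 1` and `t + 2`.
  below above : ℕ → Fin n → Bool
  below t i = does (pos i ≤? suc t)
  above t i = not (below t i)

  -- Exclusive or makes the set independent of the order in which `pairs` presents the two edges.
  between : ℕ × ℕ → Fin n → Bool
  between (s , t) i = below s i Bool.xor below t i

  open Scheme L below above between (upTo m)

  module _ {V : Vec Bool n} {E : Vec (Vec Bool n) n} (C : IsConnSub G V E) where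
    open IsConnSub C

    In : Fin n → Set
    In i = lookup V i ≡ true

    Step : Fin n → Fin n → Set
    Step i j = lookup (lookup E i) j ≡ true

    -- Each step changes the level by one, so a walk cannot jump over a level: a discrete
    -- intermediate value theorem.
    crossing-vertex : ∀ {u w q} → In u → Star Step u w → pos u ≤ q → q ≤ pos w → ∃ λ x → In x × pos x ≡ q
    crossing-vertex {u} u∈ ε p q = u , u∈ , ≤-antisym p q
    crossing-vertex {u} {q = q} u∈ (_◅_ {j = x} s ss) p r with pos u ℕ.≟ q
    ... | yes e = u , u∈ , e
    ... | no ne = crossing-vertex (proj₂ (proj₂ (subset u x s))) ss
      (case adj⇒ (proj₁ (subset u x s)) of λ
        { (inj₁ e) → subst (_≤ q) e (≤∧≢⇒< p ne)
        ; (inj₂ e) → ≤-trans (n≤1+n _) (subst (_≤ q) (sym e) p) }) r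

    crossing-edge : ∀ {u w q} → Star Step u w → pos u ≤ q → q < pos w →
      ∃₂ λ x y → Step x y × pos x ≡ q × pos y ≡ suc q
    crossing-edge ε p r = ⊥-elim (<⇒≱ r p)
    crossing-edge {u} {q = q} (_◅_ {j = x} s ss) p r with pos x ≤? q
    ... | yes le = crossing-edge ss le r
    ... | no nle with adj⇒ (proj₁ (subset u x s))
    ...   | inj₁ e = u , x , s , eq , trans (sym e) (cong suc eq)
      where
      eq : pos u ≡ q
      eq = ≤-antisym p (≤-pred (subst (q <_) (sym e) (≰⇒> nle)))
    ...   | inj₂ e = ⊥-elim (nle (≤-trans (n≤1+n _) (subst (_≤ q) (sym e) p)))

    first-step : ∀ {u w} → Star Step u w → u ≢ w → ∃ λ x → Step u x
    first-step ε ne = ⊥-elim (ne refl)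
    first-step (s ◅ _) _ = _ , s

    -- Connected subgraphs are induced. Between two path levels a walk has to cross, and each level
    -- has only one vertex, so it crosses along this very edge. If one end lies in level 0 or
    -- `suc d`, it has only one neighbour, and its first step is the edge.
    edge-up : ∀ {i j} → In i → In j → suc (pos i) ≡ pos j → Step i j
    edge-up {i} {j} i∈ j∈ e with 1 ≤? pos i | pos j ≤? d
    ... | yes 1≤i | yes j≤d with crossing-edge (connected i j i∈ j∈) ≤-refl (≤-reflexive e)
    ...   | x , y , s , px , py = subst₂ Step
      (sym (pos-inj 1≤i (≤-trans (n≤1+n _) (subst (_≤ d) (sym e) j≤d)) (sym px)))
      (sym (pos-inj (subst (1 ≤_) e (s≤s z≤n)) j≤d (trans (sym e) (sym py)))) s
    edge-up {i} {j} i∈ j∈ e | no 1≰i | _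
      with first-step (connected i j i∈ j∈) (λ { refl → ℕₚ.1+n≢n e })
    ... | x , s with adj⇒ (proj₁ (subset i x s))
    ...   | inj₁ e′ = subst (Step i) (sym (pos-inj (subst (1 ≤_) e (s≤s z≤n))
              (subst (_≤ d) e (s≤s (≤-trans (≤-pred (≰⇒> 1≰i)) z≤n))) (trans (sym e) e′))) s
    ...   | inj₂ e′ = ⊥-elim (1≰i (subst (1 ≤_) e′ (s≤s z≤n)))
    edge-up {i} {j} i∈ j∈ e | yes 1≤i | no j≰d
      with first-step (connected j i j∈ i∈) (λ { refl → ℕₚ.1+n≢n e })
    ... | x , s with adj⇒ (proj₁ (subset j x s))
    ...   | inj₁ e′ = ⊥-elim (<⇒≱ (≰⇒> j≰d) (≤-pred (subst (_≤ suc d) (sym e′) (pos≤ x))))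
    ...   | inj₂ e′ = trans (symmetric i j) (subst (Step j) (sym (pos-inj 1≤i
              (≤-pred (subst (_≤ suc d) (sym e) (pos≤ j))) (suc-injective (trans e (sym e′))))) s)

    edge : ∀ {i j} → In i → In j → adj G i j ≡ true → Step i j
    edge {i} {j} i∈ j∈ e with adj⇒ e
    ... | inj₁ e′ = edge-up i∈ j∈ e′
    ... | inj₂ e′ = trans (symmetric i j) (edge-up j∈ i∈ e′)

    -- `Occursʳ` measures levels from the top, so the search for a least number also finds the
    -- highest level.
    Occurs Occursʳ : ℕ → Set
    Occurs q = ∃ λ x → In x × pos x ≡ q
    Occursʳ q = ∃ λ x → In x × pos x + q ≡ suc d

    lowest : ∃ λ x → In x × (∀ y → In y → pos x ≤ pos y)
    lowest with least Occurs (λ q → any? λ x → (lookup V x Bool.≟ true) ×-dec (pos x ℕ.≟ q))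
                  (pos (proj₁ nonempty)) (_ , proj₂ nonempty , refl)
    ... | _ , (x , x∈ , refl) , min = x , x∈ , λ y y∈ → min (pos y) (y , y∈ , refl)

    highest : ∃ λ x → In x × (∀ y → In y → pos y ≤ pos x)
    highest with least Occursʳ (λ q → any? λ x → (lookup V x Bool.≟ true) ×-dec (pos x + q ℕ.≟ suc d))
                   (suc d ∸ pos (proj₁ nonempty)) (_ , proj₂ nonempty , m+[n∸m]≡n (pos≤ _))
    ... | q , (x , x∈ , e) , min = x , x∈ , λ y y∈ →
      ℕₚ.+-cancelʳ-≤ q (pos y) (pos x) (≤-trans
        (+-monoʳ-≤ (pos y) (min (suc d ∸ pos y) (y , y∈ , m+[n∸m]≡n (pos≤ y))))
        (≤-reflexive (trans (m+[n∸m]≡n (pos≤ y)) (sym e))))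

    x₀ = proj₁ lowest
    x₁ = proj₁ highest
    x₀∈ : In x₀
    x₀∈ = proj₁ (proj₂ lowest)
    x₁∈ : In x₁
    x₁∈ = proj₁ (proj₂ highest)
    lo = pos x₀
    hi = pos x₁

    ≥lo : ∀ {y} → In y → lo ≤ pos y
    ≥lo = proj₂ (proj₂ lowest) _
    ≤hi : ∀ {y} → In y → pos y ≤ hi
    ≤hi = proj₂ (proj₂ highest) _

    -- Vertices of equal level are never adjacent, so a connected subgraph inside one level is a
    -- single vertex.
    singleton : lo ≡ hi → L x₀ ≡ true → V ∈ codes
    singleton e Lx = subst (_∈ codes) (sym V≡) (∈-codes-single Lx)
      where
      only : ∀ {y} → In y → y ≡ x₀
      only {y} y∈ with y ≟ x₀
      ... | yes p = p
      ... | no ne with first-step (connected y x₀ y∈ x₀∈) ne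
      ...   | z , s with subset y z s
      ...     | yz , _ , z∈ = ⊥-elim (clash (adj⇒ yz))
        where
        level : ∀ {y} → In y → pos y ≡ lo
        level {w} w∈ = ≤-antisym (subst (pos w ≤_) (sym e) (≤hi w∈)) (≥lo w∈)
        clash : Consecutive (pos y) (pos z) → ⊥
        clash rewrite level y∈ | level z∈ = λ { (inj₁ p) → ℕₚ.1+n≢n p ; (inj₂ p) → ℕₚ.1+n≢n p }
      V≡ : V ≡ single x₀
      V≡ = vec-ext λ i → bool-ext
        (λ i∈ → trans (cong (lookup (single x₀)) (only i∈)) (single-self x₀))
        (λ p → subst In (sym (single-only x₀ i p)) x₀∈)

    -- By `crossing-vertex`, `V` contains every path vertex between its extreme levels. The first
    -- hypothesis on `S` concerns path levels only, because the family leaves pendant vertices free.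
    interval : ∀ {S} → S ∈ shapes → (∀ {i} → 1 ≤ pos i → pos i ≤ d → S i ≡ true → lo ≤ pos i × pos i ≤ hi) →
      (∀ {i} → lo ≤ pos i → pos i ≤ hi → S i ≡ true) → V ∈ codes
    interval {S} S∈ sound complete = ∈-codes-fam S∈ (∈-fam⁺ L S V
      (λ i e → bool-ext (λ i∈ → complete (≥lo i∈) (≤hi i∈)) (fill e))
      (λ i i∈ → complete (≥lo i∈) (≤hi i∈)))
      where
      fill : ∀ {i} → L i ≡ false → S i ≡ true → In i
      fill e Si with L-false e
      ... | 1≤p , p≤d with sound 1≤p p≤d Si
      ...   | l , h with crossing-vertex x₀∈ (connected x₀ x₁ x₀∈ x₁∈) l h
      ...     | x , x∈ , px = subst In (sym (pos-inj 1≤p p≤d (sym px))) x∈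

    suc-pred-hi : hi ≢ 0 → suc (hi ∸ 1) ≡ hi
    suc-pred-hi h≢0 = m+[n∸m]≡n (ℕₚ.n≢0⇒n>0 h≢0)

    -- A subgraph without path vertices lies within level 0 or level `suc d`. Otherwise, whether its
    -- levels reach the first and the last path vertex selects the whole set, `below`, `above` or
    -- `between`.
    vertices∈codes : V ∈ codes
    vertices∈codes with hi ℕ.≟ 0 | lo ℕ.≟ suc d
    ... | yes h≡0 | _ = singleton (trans l≡0 (sym h≡0)) (L-true⁺ (inj₁ l≡0))
      where
      l≡0 : lo ≡ 0
      l≡0 = ℕₚ.n≤0⇒n≡0 (subst (lo ≤_) h≡0 (≤hi x₀∈))
    ... | no _ | yes l≡ = singleton
      (≤-antisym (≤hi x₀∈) (subst (hi ≤_) (sym l≡) (pos≤ x₁))) (L-true⁺ (inj₂ l≡))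
    ... | no h≢0 | no l≢ with lo ≤? 1 | d ≤? hi
    ...   | yes l≤1 | yes d≤h = interval (here refl) (λ p q _ → ≤-trans l≤1 p , ≤-trans q d≤h) (λ _ _ → refl)
    ...   | yes l≤1 | no d≰h = interval (∈-shapes-A (∈-upTo⁺ t<m))
      (λ {i} p q e → ≤-trans l≤1 p , subst (pos i ≤_) st≡ (does⁻ (pos i ≤? suc t) e))
      (λ {i} p q → dec-true (pos i ≤? suc t) (subst (pos i ≤_) (sym st≡) q))
      where
      -- `below t` ends at level `t + 1`.
      t = hi ∸ 1
      st≡ : suc t ≡ hi
      st≡ = suc-pred-hi h≢0
      t<m : t < m
      t<m = ≤-pred (subst (_< d) (sym st≡) (≰⇒> d≰h))
    ...   | no l≰1 | yes d≤h = interval (∈-shapes-B (∈-upTo⁺ s<m))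
      (λ {i} p q e → subst (_≤ pos i) ss≡ (≰⇒> (does-no (pos i ≤? suc s) (Boolₚ.not-injective {y = false} e))) , ≤-trans q d≤h)
      (λ {i} p q → cong not (dec-false (pos i ≤? suc s) (<⇒≱ (subst (_≤ pos i) (sym ss≡) p))))
      where
      -- `above s` starts at level `s + 2`.
      s = lo ∸ 2
      ss≡ : suc (suc s) ≡ lo
      ss≡ = m+[n∸m]≡n (≰⇒> l≰1)
      s<m : s < m
      s<m = ≤-pred (subst (_≤ d) (sym ss≡) (≤-pred (≤∧≢⇒< (pos≤ x₀) l≢)))
    ...   | no l≰1 | no d≰h = case ∈-pairs⁺ (∈-upTo⁺ {i = s} (<-≤-trans s<t (<⇒≤ t<m))) (∈-upTo⁺ t<m) (<⇒≢ s<t) of λ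
      { (inj₁ m∈) → interval (∈-shapes-mid m∈) sound complete
      ; (inj₂ m∈) → interval (∈-shapes-mid m∈)
          (λ {i} p q e → sound p q (trans (Boolₚ.xor-comm (below s i) (below t i)) e))
          (λ {i} p q → trans (Boolₚ.xor-comm (below t i) (below s i)) (complete p q)) }
      where
      s = lo ∸ 2
      t = hi ∸ 1
      ss≡ : suc (suc s) ≡ lo
      ss≡ = m+[n∸m]≡n (≰⇒> l≰1)
      st≡ : suc t ≡ hi
      st≡ = suc-pred-hi h≢0
      t<m : t < m
      t<m = ≤-pred (subst (_< d) (sym st≡) (≰⇒> d≰h))
      s<t : s < t
      s<t = ≤-pred (subst₂ _≤_ (sym ss≡) (sym st≡) (≤hi x₀∈))
      sound : ∀ {i} → 1 ≤ pos i → pos i ≤ d → between (s , t) i ≡ true → lo ≤ pos i × pos i ≤ hi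
      sound {i} _ _ e with pos i ≤? suc s | pos i ≤? suc t
      ... | yes p | no q  = ⊥-elim (q (≤-trans p (s≤s (<⇒≤ s<t))))
      ... | no p  | yes q = subst (_≤ pos i) ss≡ (≰⇒> p) , subst (pos i ≤_) st≡ q
      ... | yes p | yes q = case trans (sym e) (cong₂ Bool._xor_ (dec-true (pos i ≤? suc s) p) (dec-true (pos i ≤? suc t) q)) of λ ()
      ... | no p  | no q  = case trans (sym e) (cong₂ Bool._xor_ (dec-false (pos i ≤? suc s) p) (dec-false (pos i ≤? suc t) q)) of λ ()
      complete : ∀ {i} → lo ≤ pos i → pos i ≤ hi → between (s , t) i ≡ true
      complete {i} p q = cong₂ Bool._xor_
        (dec-false (pos i ≤? suc s) (<⇒≱ (subst (_≤ pos i) (sym ss≡) p)))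
        (dec-true (pos i ≤? suc t) (subst (pos i ≤_) (sym st≡) q))

  vertices-injective : ∀ {C D : ConnSub G} → ConnSub.V C ≡ ConnSub.V D → C ≡ D
  vertices-injective {C} {D} e = connSub-≡ e (vec-ext λ i → vec-ext λ j → bool-ext
    (inherit C D (cong lookup e) i j) (inherit D C (cong lookup (sym e)) i j))
    where
    inherit : ∀ C D → lookup (ConnSub.V C) ≡ lookup (ConnSub.V D) → ∀ i j →
      lookup (lookup (ConnSub.E C) i) j ≡ true → lookup (lookup (ConnSub.E D) i) j ≡ true
    inherit C D V≡ i j s with IsConnSub.subset (valid C) i j s
    ... | ij , i∈ , j∈ = edge (valid D) (trans (sym (cong-app V≡ i)) i∈) (trans (sym (cong-app V≡ j)) j∈) ij

  -- Below a cut only pendant vertices of level 0 are free, above it only those of level `suc d`,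
  -- and between two cuts none: hence the factors `2 ^ a`, `2 ^ b` and 1.
  coreIndex≤ : ∀ {c} → CoreIndex G c →
    c ≤ (a + b) + (2 ^ (a + b) + (m * 2 ^ a + (m * 2 ^ b + triangle m)))
  coreIndex≤ e = ≤-trans
    (injective-image≤ e ConnSub.V vertices-injective (λ C → vertices∈codes (valid C)))
    (≤-trans (≤-reflexive length-codes)
      (+-mono-≤ L≤ (+-mono-≤ (^-monoʳ-≤ 2 L≤) (+-mono-≤
        (total below (upTo m) a (length-upTo m) λ t∈ → cnt-mono-low (∈-upTo⁻ t∈))
        (+-mono-≤ (total above (upTo m) b (length-upTo m) λ {t} t∈ → cnt-mono-high (∈-upTo⁻ t∈))
          (≤-trans (total between (pairs (upTo m)) 0
              (trans (length-pairs (upTo m)) (cong triangle (length-upTo m)))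
              λ {p} p∈ → ≤-reflexive (cnt≡0 {M = λ i → L i ∧ between p i} λ i → no-end p (∈-pairs⁻ (Uniqueₚ.upTo⁺ m) p∈)))
            (≤-reflexive (*-identityʳ (triangle m)))))))))
    where
    L≤ : cnt L ≤ a + b
    L≤ = ≤-trans (cnt-∨ (λ i → does (pos i ℕ.≟ 0)) (λ i → does (pos i ℕ.≟ suc d))) (+-mono-≤ low≤ high≤)
    total : ∀ {J : Set} (F : J → Fin n → Bool) js c {l} → length js ≡ l →
      (∀ {j} → j ∈ js → cnt (λ i → L i ∧ F j i) ≤ c) → sum (map (weight ∘ F) js) ≤ l * 2 ^ c
    total F js c refl le = ≤-trans (sum-mono (weight ∘ F) (λ _ → 2 ^ c) js (λ j∈ → ^-monoʳ-≤ 2 (le j∈)))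
      (≤-reflexive (sum-const (2 ^ c) js))
    not-low : ∀ {t i} → pos i ≡ 0 → below t i ≡ true
    not-low {t} {i} p = dec-true (pos i ≤? suc t) (subst (_≤ suc t) (sym p) z≤n)
    not-high : ∀ {t i} → t < m → pos i ≡ suc d → below t i ≡ false
    not-high {t} {i} t<m p = dec-false (pos i ≤? suc t) λ q → <⇒≱ (s≤s (s≤s (<⇒≤ t<m))) (subst (_≤ suc t) p q)
    cnt-mono-low : ∀ {t} → t < m → cnt (λ i → L i ∧ below t i) ≤ a
    cnt-mono-low {t} t<m = ≤-trans (cnt-mono λ i e → case L-true⁻ {i} (proj₁ (∧-true e)) of λ
      { (inj₁ p) → dec-true (pos i ℕ.≟ 0) p
      ; (inj₂ p) → ⊥-elim (true≢false (proj₂ (∧-true {L i} e)) (not-high t<m p)) }) low≤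
    cnt-mono-high : ∀ {t} → t < m → cnt (λ i → L i ∧ above t i) ≤ b
    cnt-mono-high {t} t<m = ≤-trans (cnt-mono λ i e → case L-true⁻ {i} (proj₁ (∧-true e)) of λ
      { (inj₁ p) → ⊥-elim (true≢false (proj₂ (∧-true {L i} e)) (cong not (not-low {t} p)))
      ; (inj₂ p) → dec-true (pos i ℕ.≟ suc d) p }) high≤
    no-end : ∀ p {i} → proj₁ p ∈ upTo m × proj₂ p ∈ upTo m × proj₁ p ≢ proj₂ p →
      L i ∧ between p i ≡ true → ⊥
    no-end (s , t) {i} (s∈ , t∈ , _) e = case L-true⁻ {i} (proj₁ (∧-true e)) of λ
      { (inj₁ p) → true≢false (proj₂ (∧-true {L i} e)) (cong₂ Bool._xor_ (not-low {s} p) (not-low {t} p))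
      ; (inj₂ p) → true≢false (proj₂ (∧-true {L i} e))
          (cong₂ Bool._xor_ (not-high (∈-upTo⁻ s∈) p) (not-high (∈-upTo⁻ t∈) p)) }

-- Spanning trees given by a parent function and a depth function

record SpanningTree {n} (G : Graph n) (L : Fin n → Bool) : Set where
  field
    r        : Fin n
    parent   : Fin n → Fin n
    depth    : Fin n → ℕ
    adjacent : ∀ {v} → v ≢ r → adj G v (parent v) ≡ true
    depth-r  : depth r ≡ 0
    depth-p  : ∀ {v} → v ≢ r → depth v ≡ suc (depth (parent v))
    L-root   : L r ≡ false
    L-parent : ∀ {v} → v ≢ r → L (parent v) ≡ false

-- Distinct subtrees cut out of a spanning tree

module TreeBound {n} {G : Graph n} {L : Fin n → Bool} (tree : SpanningTree G L) where
  open SpanningTree tree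

  -- Climbs from `w` in search of `v`; the fuel `depth w` is exactly the number of steps up to the
  -- root.
  descFrom : ℕ → Fin n → Fin n → Bool
  descFrom zero    v w = does (w ≟ v)
  descFrom (suc m) v w = does (w ≟ v) ∨ descFrom m v (parent w)

  desc : Fin n → Fin n → Bool
  desc v w = descFrom (depth w) v w

  desc-self : ∀ v → desc v v ≡ true
  desc-self v with depth v
  ... | zero  = dec-true (v ≟ v) refl
  ... | suc m rewrite dec-true (v ≟ v) refl = refl

  desc-step : ∀ {v w} → w ≢ r → w ≢ v → desc v w ≡ desc v (parent w)
  desc-step {v} {w} w≢r w≢v rewrite depth-p w≢r | dec-false (w ≟ v) w≢v = refl

  desc-of-root : ∀ {v} → v ≢ r → desc v r ≡ false
  desc-of-root {v} v≢r rewrite depth-r = dec-false (r ≟ v) (v≢r ∘ sym)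

  depth-induction : (P : Fin n → Set) → P r → (∀ {w} → w ≢ r → P (parent w) → P w) → ∀ w → P w
  depth-induction P base step w = go (depth w) w refl
    where
    go : ∀ m w → depth w ≡ m → P w
    go m w e with w ≟ r
    ... | yes refl = base
    go zero w e | no w≢r = case trans (sym e) (depth-p w≢r) of λ ()
    go (suc m) w e | no w≢r = step w≢r (go m (parent w) (suc-injective (trans (sym (depth-p w≢r)) e)))

  root-desc : ∀ w → desc r w ≡ true
  root-desc = depth-induction _ (desc-self r) (λ w≢r ih → trans (desc-step w≢r w≢r) ih)

  desc-depth≤ : ∀ {v} w → desc v w ≡ true → depth v ≤ depth w
  desc-depth≤ {v} = depth-induction _ atRoot λ {w} w≢r ih e → step w≢r ih e
    where
    atRoot : desc v r ≡ true → depth v ≤ depth r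
    atRoot e with v ≟ r
    ... | yes refl = ≤-refl
    ... | no v≢r = ⊥-elim (true≢false e (desc-of-root v≢r))
    step : ∀ {w} → w ≢ r → (desc v (parent w) ≡ true → depth v ≤ depth (parent w)) →
      desc v w ≡ true → depth v ≤ depth w
    step {w} w≢r ih e with w ≟ v
    ... | yes refl = ≤-refl
    ... | no w≢v = ≤-trans (ih (trans (sym (desc-step w≢r w≢v)) e))
      (≤-trans (n≤1+n _) (≤-reflexive (sym (depth-p w≢r))))

  desc-parent : ∀ {v} → v ≢ r → desc v (parent v) ≡ false
  desc-parent {v} v≢r = not-true λ e →
    <⇒≱ (≤-reflexive (sym (depth-p v≢r))) (desc-depth≤ (parent v) e)

  desc-antisym : ∀ {u v} → u ≢ v → desc v u ≡ true → desc u v ≡ false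
  desc-antisym {u} {v} u≢v e with u ≟ r
  ... | yes refl with v ≟ r
  ...   | yes refl = ⊥-elim (u≢v refl)
  ...   | no v≢r = ⊥-elim (true≢false e (desc-of-root v≢r))
  desc-antisym {u} {v} u≢v e | no u≢r = not-true λ e′ →
    <⇒≱ (≤-reflexive (sym (depth-p u≢r)))
      (≤-trans (desc-depth≤ v e′) (desc-depth≤ (parent u) (trans (sym (desc-step u≢r u≢v)) e)))

  -- Vertex sets closed under taking parents, up to a top vertex, span subtrees.
  Convex : Vec Bool n → Set
  Convex V = ∃ λ t → lookup V t ≡ true ×
    (∀ w → lookup V w ≡ true → w ≢ t → w ≢ r × lookup V (parent w) ≡ true)

  Link : Fin n → Fin n → Set
  Link i j = i ≢ r × parent i ≡ j

  link? : ∀ i j → Dec (Link i j)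
  link? i j = ¬? (i ≟ r) ×-dec (parent i ≟ j)

  module _ (V : Vec Bool n) where
    InTree : Fin n → Fin n → Set
    InTree i j = lookup V i ≡ true × lookup V j ≡ true × (Link i j ⊎ Link j i)

    inTree? : ∀ i j → Dec (InTree i j)
    inTree? i j = (lookup V i Bool.≟ true) ×-dec (lookup V j Bool.≟ true) ×-dec (link? i j ⊎-dec link? j i)

    treeEdges : Vec (Vec Bool n) n
    treeEdges = Vec.tabulate λ i → Vec.tabulate λ j → does (inTree? i j)

    treeEdges-lookup : ∀ i j → lookup (lookup treeEdges i) j ≡ does (inTree? i j)
    treeEdges-lookup i j = trans (cong (λ row → lookup row j) (lookup∘tabulate (λ i → Vec.tabulate λ j → does (inTree? i j)) i)) (lookup∘tabulate _ j)

    treeEdges⁺ : ∀ {i j} → InTree i j → lookup (lookup treeEdges i) j ≡ true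
    treeEdges⁺ {i} {j} p = trans (treeEdges-lookup i j) (dec-true (inTree? i j) p)

    treeEdges⁻ : ∀ {i j} → lookup (lookup treeEdges i) j ≡ true → InTree i j
    treeEdges⁻ {i} {j} e = does⁻ (inTree? i j) (trans (sym (treeEdges-lookup i j)) e)

    inTree-sym : ∀ {i j} → InTree i j → InTree j i
    inTree-sym (p , q , l) = q , p , Sum.swap l

    convex⇒connSub : Convex V → IsConnSub G V treeEdges
    convex⇒connSub (t , t∈ , closed) = isConnSub (t , t∈)
      (λ i j → bool-ext (treeEdges⁺ ∘ inTree-sym ∘ treeEdges⁻) (treeEdges⁺ ∘ inTree-sym ∘ treeEdges⁻))
      (λ i j e → case treeEdges⁻ e of λ
        { (p , q , inj₁ (i≢r , refl)) → adjacent i≢r , p , q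
        ; (p , q , inj₂ (j≢r , refl)) → trans (Graph.sym G i j) (adjacent j≢r) , p , q })
      (λ u v u∈ v∈ → toTop u u∈ ◅◅ Starₚ.reverse (treeEdges⁺ ∘ inTree-sym ∘ treeEdges⁻) (toTop v v∈))
      where
      toTop : ∀ u → lookup V u ≡ true → Star (λ i j → lookup (lookup treeEdges i) j ≡ true) u t
      toTop = depth-induction _ atRoot step
        where
        atRoot : lookup V r ≡ true → Star _ r t
        atRoot r∈ with r ≟ t
        ... | yes refl = ε
        ... | no r≢t = ⊥-elim (proj₁ (closed r r∈ r≢t) refl)
        step : ∀ {w} → w ≢ r → (lookup V (parent w) ≡ true → Star _ (parent w) t) →
          lookup V w ≡ true → Star _ w t
        step {w} w≢r ih w∈ with w ≟ t
        ... | yes refl = ε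
        ... | no w≢t with closed w w∈ w≢t
        ...   | _ , pw∈ = treeEdges⁺ (w∈ , pw∈ , inj₁ (w≢r , refl)) ◅ ih pw∈

  ConvexShape : (Fin n → Bool) → Set
  ConvexShape S = ∃ λ t → L t ≡ false × S t ≡ true ×
    (∀ w → S w ≡ true → w ≢ t → w ≢ r × S (parent w) ≡ true)

  -- The top vertex and all parents lie off `L`, so discarding pendant vertices never disconnects
  -- the set.
  convex-fam : ∀ {S V} → ConvexShape S → V ∈ fam L S → Convex V
  convex-fam {S} {V} (t , Lt , St , closed) V∈ = t , trans (fam-off L S V V∈ t Lt) St ,
    λ w w∈ w≢t → case closed w (fam-⊆ L S V V∈ w w∈) w≢t of λ
      { (w≢r , Sp) → w≢r , trans (fam-off L S V V∈ (parent w) (L-parent w≢r)) Sp }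

  -- A component left by removing tree edges is what lies below its top `t` but below none of the
  -- cut vertices `cs`. Passing from `w` to its parent leaves the region below `t` only at `t`, and
  -- cannot enter the region below a `c`.
  convex-shape : ∀ {S} t (cs : List (Fin n)) → L t ≡ false → All (λ c → desc c t ≡ false) cs →
    (∀ {w} → S w ≡ true → desc t w ≡ true × All (λ c → desc c w ≡ false) cs) →
    (∀ {w} → desc t w ≡ true → All (λ c → desc c w ≡ false) cs → S w ≡ true) → ConvexShape S
  convex-shape {S} t cs Lt cut sound complete = t , Lt , complete (desc-self t) cut , λ w Sw w≢t →
    let tw , csw = sound Sw
        w≢r : w ≢ r
        w≢r = λ { refl → true≢false tw (desc-of-root (w≢t ∘ sym)) }
    in w≢r , complete (trans (sym (desc-step w≢r w≢t)) tw)
         (All.map (λ {c} e → trans (sym (desc-step w≢r (λ { refl → true≢false (desc-self w) e }))) e) csw)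

  -- An inner vertex stands for the tree edge to its parent, so `inners` indexes the edges of the
  -- tree on the non-pendant vertices.
  inner : Fin n → Bool
  inner i = not (L i) ∧ not (does (i ≟ r))

  inners : List (Fin n)
  inners = elems inner

  inner⁻ : ∀ {v} → v ∈ inners → L v ≡ false × v ≢ r
  inner⁻ {v} v∈ with ∧-true {not (L v)} (∈-elems⁻ {M = inner} v∈)
  ... | e , e′ = Boolₚ.not-injective {y = false} e , does-no (v ≟ r) (Boolₚ.not-injective {y = false} e′)

  inner⁺ : ∀ {v} → L v ≡ false → v ≢ r → v ∈ inners
  inner⁺ {v} e v≢r = ∈-elems⁺ {M = inner} (cong₂ (λ x y → not x ∧ not y) e (dec-false (v ≟ r) v≢r))

  -- Removing the tree edges above u and v leaves three components; this one meets both edges.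
  middle : Bool → Bool → Bool → Bool → Bool
  middle true  _     au av = av ∧ not au
  middle false true  au av = au ∧ not av
  middle false false au av = not au ∧ not av

  mid : Fin n × Fin n → Fin n → Bool
  mid (u , v) w = middle (desc v u) (desc u v) (desc u w) (desc v w)

  codesc : Fin n → Fin n → Bool
  codesc v w = not (desc v w)

  open Scheme L desc codesc mid inners public

  -- The tree edge above `w` has exactly one end in `S`.
  Cut : (Fin n → Bool) → Fin n → Set
  Cut S w = S w ≢ S (parent w)

  cut-desc : ∀ {v} → v ≢ r → Cut (desc v) v
  cut-desc {v} v≢r e = true≢false (desc-self v) (trans e (desc-parent v≢r))

  cut-codesc : ∀ {v} → v ≢ r → Cut (codesc v) v
  cut-codesc v≢r e = cut-desc v≢r (Boolₚ.not-injective e)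

  mid-nocut : ∀ {u v w} → w ≢ r → w ≢ u → w ≢ v → mid (u , v) w ≡ mid (u , v) (parent w)
  mid-nocut {u} {v} w≢r w≢u w≢v =
    cong₂ (middle (desc v u) (desc u v)) (desc-step w≢r w≢u) (desc-step w≢r w≢v)

  mid-cutˡ : ∀ {u v} → u ≢ r → u ≢ v → Cut (mid (u , v)) u
  mid-cutˡ {u} {v} u≢r u≢v
    rewrite sym (desc-step {v} u≢r u≢v) | desc-self u | desc-parent u≢r with desc v u | desc u v
  ... | true  | _     = λ ()
  ... | false | true  = λ ()
  ... | false | false = λ ()

  mid-cutʳ : ∀ {u v} → v ≢ r → u ≢ v → Cut (mid (u , v)) v
  mid-cutʳ {u} {v} v≢r u≢v
    rewrite sym (desc-step {u} v≢r (u≢v ∘ sym)) | desc-self v | desc-parent v≢r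
    with desc v u in e | desc u v in e′
  -- `middle` consults `desc v u` first, and in this impossible nesting it would not separate `v`
  -- from its parent.
  ... | true  | true  = ⊥-elim (true≢false e′ (desc-antisym u≢v e))
  ... | true  | false = λ ()
  ... | false | true  = λ ()
  ... | false | false = λ ()

  -- The top of the middle component is the upper one of `u` and `v` if they are nested, and the
  -- root otherwise.
  mid-convex : ∀ {u v} → u ∈ inners → v ∈ inners → u ≢ v → ConvexShape (mid (u , v))
  mid-convex {u} {v} u∈ v∈ u≢v with desc v u in e | desc u v in e′
  ... | true | _ = convex-shape v (u ∷ []) (proj₁ (inner⁻ v∈)) (desc-antisym u≢v e ∷ [])
    (λ {w} q → let a , b = ∧-true {desc v w} q in a , Boolₚ.not-injective {y = false} b ∷ [])
    (λ {w} a → λ { (b ∷ []) → cong₂ _∧_ a (cong not b) })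
  ... | false | true = convex-shape u (v ∷ []) (proj₁ (inner⁻ u∈)) (e ∷ [])
    (λ {w} q → let a , b = ∧-true {desc u w} q in a , Boolₚ.not-injective {y = false} b ∷ [])
    (λ {w} a → λ { (b ∷ []) → cong₂ _∧_ a (cong not b) })
  ... | false | false = convex-shape r (u ∷ v ∷ []) L-root
    (desc-of-root (proj₂ (inner⁻ u∈)) ∷ desc-of-root (proj₂ (inner⁻ v∈)) ∷ [])
    (λ {w} q → let a , b = ∧-true {not (desc u w)} q in root-desc w ,
      Boolₚ.not-injective {y = false} a ∷ Boolₚ.not-injective {y = false} b ∷ [])
    (λ {w} _ → λ { (a ∷ b ∷ []) → cong₂ (λ x y → not x ∧ not y) a b })

  shape-convex : ∀ {S} → S ∈ shapes → ConvexShape S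
  shape-convex S∈ with ∈-shapes⁻ S∈
  ... | inj₁ refl = convex-shape r [] L-root [] (λ {w} _ → root-desc w , []) (λ _ _ → refl)
  ... | inj₂ (inj₁ (v , v∈ , inj₁ refl)) =
    convex-shape v [] (proj₁ (inner⁻ v∈)) [] (λ e → e , []) (λ e _ → e)
  ... | inj₂ (inj₁ (v , v∈ , inj₂ refl)) = convex-shape r (v ∷ []) L-root
    (desc-of-root (proj₂ (inner⁻ v∈)) ∷ [])
    (λ {w} q → root-desc w , Boolₚ.not-injective {y = false} q ∷ [])
    (λ _ → λ { (a ∷ []) → cong not a })
  ... | inj₂ (inj₂ ((u , v) , uv∈ , refl)) with ∈-pairs⁻ (elems-unique inner) uv∈
  ...   | u∈ , v∈ , u≢v = mid-convex u∈ v∈ u≢v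

  Differ : (Fin n → Bool) → (Fin n → Bool) → Set
  Differ S S′ = ∃ λ i → L i ≡ false × S i ≢ S′ i

  differ-sym : ∀ {S S′} → Differ S S′ → Differ S′ S
  differ-sym (i , Li , ne) = i , Li , ne ∘ sym

  -- An edge cut by `S` and not by `S′` forces a difference at one of its two ends, and both ends
  -- are off `L`.
  cut-differ : ∀ {S S′ w} → w ∈ inners → Cut S w → S′ w ≡ S′ (parent w) → Differ S S′
  cut-differ {S} {S′} {w} w∈ cut e with S w Bool.≟ S′ w
  ... | no ne = w , proj₁ (inner⁻ w∈) , ne
  ... | yes eq = parent w , L-parent (proj₂ (inner⁻ w∈)) , λ eq′ → cut (trans eq (trans e (sym eq′)))

  -- The whole set cuts no edge, `desc x` and `codesc x` cut only the edge above `x`, and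
  -- `mid (u , v)` exactly those above `u` and `v`. Cuts thus separate everything except `desc` from
  -- `codesc`, which the root tells apart.
  shapes-differ : AllPairs Differ shapes
  shapes-differ = All.tabulate fromTop ∷ AllPairsₚ.++⁺
    (unique-map desc λ {x} {y} x∈ y∈ x≢y →
      cut-differ {desc x} x∈ (cut-desc (proj₂ (inner⁻ x∈))) (desc-step (proj₂ (inner⁻ x∈)) x≢y))
    (AllPairsₚ.++⁺
      (unique-map codesc λ {x} {y} x∈ y∈ x≢y →
        cut-differ {codesc x} x∈ (cut-codesc (proj₂ (inner⁻ x∈))) (cong not (desc-step (proj₂ (inner⁻ x∈)) x≢y)))
      (AllPairsₚ.map⁺ (pairs-differ inners (elems-unique inner) id))
      (cross codesc λ x∈ → differ-sym ∘ fromMid (λ w∈ w≢x → cong not (desc-step (proj₂ (inner⁻ w∈)) w≢x))))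
    (All.tabulate λ {S} S∈ → Allₚ.++⁺
      (All.tabulate λ S′∈ → case ∈-map⁻ desc S∈ of λ { (x , x∈ , refl) → case ∈-map⁻ codesc S′∈ of λ
        { (y , y∈ , refl) → r , L-root , λ e → true≢false
            (trans e (cong not (desc-of-root (proj₂ (inner⁻ y∈))))) (desc-of-root (proj₂ (inner⁻ x∈))) } })
      (All.lookup (cross desc λ x∈ → differ-sym ∘ fromMid (λ w∈ w≢x → desc-step (proj₂ (inner⁻ w∈)) w≢x)) S∈))
    where
    unique-map : (F : Fin n → Fin n → Bool) →
      (∀ {x y} → x ∈ inners → y ∈ inners → x ≢ y → Differ (F x) (F y)) → AllPairs Differ (map F inners)
    unique-map F d = AllPairsₚ.map⁺ (go inners (elems-unique inner) id)
      where
      go : ∀ xs → Unique xs → (∀ {x} → x ∈ xs → x ∈ inners) → AllPairs (λ x y → Differ (F x) (F y)) xs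
      go [] _ _ = []
      go (x ∷ xs) (x∉ ∷ u) sub = All.tabulate (λ y∈ → d (sub (here refl)) (sub (there y∈)) (All.lookup x∉ y∈))
        ∷ go xs u (sub ∘ there)
    pairs-differ : ∀ xs → Unique xs → (∀ {x} → x ∈ xs → x ∈ inners) →
      AllPairs (λ p q → Differ (mid p) (mid q)) (pairs xs)
    pairs-differ [] _ _ = []
    pairs-differ (x ∷ xs) (x∉ ∷ u) sub = AllPairsₚ.++⁺
      (AllPairsₚ.map⁺ (row xs u (λ y∈ → sub (there y∈) , All.lookup x∉ y∈)))
      (pairs-differ xs u (sub ∘ there))
      (Allₚ.map⁺ (All.tabulate λ {y} y∈ → All.tabulate λ { {a , b} ab∈ → case ∈-pairs⁻ u ab∈ of λ
        { (a∈ , b∈ , _) → cut-differ {mid (x , y)} (sub (here refl)) (mid-cutˡ x≢r (All.lookup x∉ y∈))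
            (mid-nocut {a} {b} x≢r (All.lookup x∉ a∈) (All.lookup x∉ b∈)) } }))
      where
      x≢r : x ≢ r
      x≢r = proj₂ (inner⁻ (sub (here refl)))
      row : ∀ ys → Unique ys → (∀ {y} → y ∈ ys → y ∈ inners × x ≢ y) →
        AllPairs (λ y y′ → Differ (mid (x , y)) (mid (x , y′))) ys
      row [] _ _ = []
      row (y ∷ ys) (y∉ ∷ v) sub′ = All.tabulate (λ {y′} y′∈ → case sub′ (here refl) of λ
          { (y∈ , x≢y) → cut-differ {mid (x , y)} y∈ (mid-cutʳ {x} (proj₂ (inner⁻ y∈)) x≢y)
              (mid-nocut {x} {y′} (proj₂ (inner⁻ y∈)) (x≢y ∘ sym) (All.lookup y∉ y′∈)) })
        ∷ row ys v (sub′ ∘ there)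
    fromMid : ∀ {x S} → (∀ {w} → w ∈ inners → w ≢ x → S w ≡ S (parent w)) →
      ∀ {uv} → uv ∈ pairs inners → Differ (mid uv) S
    fromMid {x} nocut {u , v} uv∈ with ∈-pairs⁻ (elems-unique inner) uv∈
    ... | u∈ , v∈ , u≢v with u ≟ x
    ...   | no u≢x = cut-differ {mid (u , v)} u∈ (mid-cutˡ (proj₂ (inner⁻ u∈)) u≢v) (nocut u∈ u≢x)
    ...   | yes refl = cut-differ {mid (u , v)} v∈ (mid-cutʳ {u} (proj₂ (inner⁻ v∈)) u≢v) (nocut v∈ (u≢v ∘ sym))
    cross : (F : Fin n → Fin n → Bool) →
      (∀ {x} → x ∈ inners → ∀ {uv} → uv ∈ pairs inners → Differ (F x) (mid uv)) →
      All (λ S → All (Differ S) (map mid (pairs inners))) (map F inners)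
    cross F d = Allₚ.map⁺ (All.tabulate λ x∈ → Allₚ.map⁺ (All.tabulate λ uv∈ → d x∈ uv∈))
    fromTop : ∀ {S} → S ∈ map desc inners ++ map codesc inners ++ map mid (pairs inners) →
      Differ (λ _ → true) S
    fromTop S∈ with ∈-++⁻ (map desc inners) S∈
    ... | inj₁ p with ∈-map⁻ desc p
    ...   | v , v∈ , refl = differ-sym (cut-differ {desc v} v∈ (cut-desc (proj₂ (inner⁻ v∈))) refl)
    fromTop S∈ | inj₂ q with ∈-++⁻ (map codesc inners) q
    ... | inj₁ p with ∈-map⁻ codesc p
    ...   | v , v∈ , refl = differ-sym (cut-differ {codesc v} v∈ (cut-codesc (proj₂ (inner⁻ v∈))) refl)
    fromTop S∈ | inj₂ q | inj₂ p with ∈-map⁻ mid p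
    ...   | (u , v) , uv∈ , refl with ∈-pairs⁻ (elems-unique inner) uv∈
    ...     | u∈ , v∈ , u≢v =
      differ-sym (cut-differ {mid (u , v)} u∈ (mid-cutˡ (proj₂ (inner⁻ u∈)) u≢v) refl)

  codes! : Unique codes
  codes! = codes-unique (λ S∈ → let t , Lt , St , _ = shape-convex S∈ in t , Lt , St) shapes-differ

  codes-convex : All Convex codes
  codes-convex = All.tabulate λ {V} V∈ → case ∈-codes⁻ V∈ of λ
    { (inj₁ (x , _ , refl)) → x , single-self x , λ w w∈ w≢x → ⊥-elim (w≢x (single-only x w w∈))
    ; (inj₂ (S , S∈ , V∈S)) → convex-fam (shape-convex S∈) V∈S }

  subtree : ∀ {V} → Convex V → ConnSub G
  subtree {V} c = connSub (convex⇒connSub V c)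

  subtrees : List (ConnSub G)
  subtrees = All.reduce {P = Convex} (λ {V} → subtree {V}) codes-convex

  subtrees! : Unique subtrees
  subtrees! = reduce-unique {P = Convex} (λ {V} → subtree {V}) ConnSub.V (λ _ → refl) codes! codes-convex

  length-subtrees : length subtrees ≡ length codes
  length-subtrees = length-reduce {P = Convex} (λ {V} → subtree {V}) codes-convex

-- The numerical lower bound

module TreeTight {n} {G : Graph n} {L : Fin n → Bool} (tree : SpanningTree G L) where
  open SpanningTree tree
  open TreeBound tree

  k m : ℕ
  k = cnt L
  m = length inners

  split : Fin n → ℕ
  split v = weight (desc v) + weight (codesc v)

  halves≤split : ∀ v → halves k ≤ split v
  halves≤split v = subst (λ c → halves c ≤ split v) (cnt-split L (desc v))
    (halves≤ (cnt (λ i → L i ∧ desc v i)) (cnt (λ i → L i ∧ not (desc v i))))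

  splits mids : ℕ
  splits = sum (map split inners)
  mids = sum (map (weight ∘ mid) (pairs inners))

  length-codes′ : length codes ≡ k + (2 ^ k + (splits + mids))
  length-codes′ = trans length-codes (cong (λ z → k + (2 ^ k + z))
    (trans (sym (+-assoc (sum (map (weight ∘ desc) inners)) _ _))
      (cong (_+ mids) (sym (sum-map-+ (weight ∘ desc) (weight ∘ codesc) inners)))))

  splits≥ : m * halves k ≤ splits
  splits≥ = ≤-trans (≤-reflexive (sym (sum-const (halves k) inners)))
    (sum-mono (λ _ → halves k) split inners (λ _ → halves≤split _))

  triangle≡ : sum (map (λ _ → 1) (pairs inners)) ≡ triangle m
  triangle≡ = trans (sum-const 1 (pairs inners)) (trans (*-identityʳ _) (length-pairs inners))

  mids≥ : triangle m ≤ mids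
  mids≥ = ≤-trans (≤-reflexive (sym triangle≡))
    (sum-mono (λ _ → 1) (weight ∘ mid) (pairs inners) (λ {p} _ → m^n>0 2 (cnt (λ i → L i ∧ mid p i))))

  bound≤codes : bound k m ≤ length codes
  bound≤codes = ≤-trans (+-monoʳ-≤ k (+-monoʳ-≤ (2 ^ k) (+-mono-≤ splits≥ mids≥)))
    (≤-reflexive (sym length-codes′))

  codes≤coreIndex : ∀ {a} → CoreIndex G a → length codes ≤ a
  codes≤coreIndex e = ≤-trans (≤-reflexive (sym length-subtrees)) (length-unique≤ e subtrees!)

  bound≤coreIndex : ∀ {a} → CoreIndex G a → bound k m ≤ a
  bound≤coreIndex e = ≤-trans bound≤codes (codes≤coreIndex e)

  at-most-two-cuts : ∀ {S u v} → (∀ {w} → w ∈ inners → w ≢ u → w ≢ v → S w ≡ S (parent w)) →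
    ∀ {x y z} → x ∈ inners → y ∈ inners → z ∈ inners → x ≢ y → x ≢ z → y ≢ z →
    Cut S x → Cut S y → Cut S z → ⊥
  at-most-two-cuts {S} {u} {v} nocut x∈ y∈ z∈ x≢y x≢z y≢z cx cy cz
    with one x∈ cx | one y∈ cy | one z∈ cz
    where
    one : ∀ {w} → w ∈ inners → Cut S w → w ≡ u ⊎ w ≡ v
    one {w} w∈ c with w ≟ u | w ≟ v
    ... | yes e | _ = inj₁ e
    ... | no _ | yes e = inj₂ e
    ... | no p | no q = ⊥-elim (c (nocut w∈ p q))
  ... | inj₁ p | inj₁ q | _ = x≢y (trans p (sym q))
  ... | inj₂ p | inj₂ q | _ = x≢y (trans p (sym q))
  ... | inj₁ p | inj₂ q | inj₁ s = x≢z (trans p (sym s))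
  ... | inj₁ p | inj₂ q | inj₂ s = y≢z (trans q (sym s))
  ... | inj₂ p | inj₁ q | inj₁ s = y≢z (trans q (sym s))
  ... | inj₂ p | inj₁ q | inj₂ s = x≢z (trans p (sym s))

  -- Serves to recognise a set that cuts three tree edges as missing from the list.
  shape-cuts : ∀ {S} → S ∈ shapes →
    ∀ {x y z} → x ∈ inners → y ∈ inners → z ∈ inners → x ≢ y → x ≢ z → y ≢ z →
    Cut S x → Cut S y → Cut S z → ⊥
  shape-cuts S∈ x∈ with ∈-shapes⁻ S∈
  ... | inj₁ refl = λ _ _ _ _ _ cx _ _ → cx refl
  ... | inj₂ (inj₁ (v , v∈ , inj₁ refl)) =
    at-most-two-cuts {desc v} {v} {v} (λ w∈ p _ → desc-step (proj₂ (inner⁻ w∈)) p) x∈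
  ... | inj₂ (inj₁ (v , v∈ , inj₂ refl)) =
    at-most-two-cuts {codesc v} {v} {v} (λ w∈ p _ → cong not (desc-step (proj₂ (inner⁻ w∈)) p)) x∈
  ... | inj₂ (inj₂ ((u , v) , _ , refl)) =
    at-most-two-cuts {mid (u , v)} {u} {v} (λ w∈ p q → mid-nocut {u} {v} (proj₂ (inner⁻ w∈)) p q) x∈

  internals : ℕ
  internals = cnt (not ∘ L)

  internals≡ : internals ≡ suc m
  internals≡ = trans (sym (length-elems (not ∘ L))) (≤-antisym
    (unique-⊆⇒length≤ (elems-unique (not ∘ L)) into)
    (unique-⊆⇒length≤ {xs = r ∷ inners}
      (All.tabulate (λ v∈ e → proj₂ (inner⁻ v∈) (sym e)) ∷ elems-unique inner) out))
    where
    into : ∀ {x} → x ∈ elems (not ∘ L) → x ∈ r ∷ inners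
    into {x} x∈ with x ≟ r
    ... | yes e = here e
    ... | no x≢r = there (inner⁺ (Boolₚ.not-injective {y = false} (∈-elems⁻ {M = not ∘ L} x∈)) x≢r)
    out : ∀ {x} → x ∈ r ∷ inners → x ∈ elems (not ∘ L)
    out (here refl) = ∈-elems⁺ {M = not ∘ L} (cong not L-root)
    out (there x∈) = ∈-elems⁺ {M = not ∘ L} (cong not (proj₁ (inner⁻ x∈)))

  -- Structure of a graph attaining the bound

  module Extremal (conn : Connected G) {a} (count : CoreIndex G a) (tight : a ≤ bound k m)
    {x₀} (Lx₀ : L x₀ ≡ true) (px₀ : parent x₀ ≡ r) (2≤k : 2 ≤ k) (1≤m : 1 ≤ m) where

    L≢ : ∀ {i j} → L i ≡ true → L j ≡ false → i ≢ j
    L≢ p q refl = true≢false p q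

    -- A subgraph off the list could be added to it, giving more than `a` distinct subgraphs. The
    -- double negation suffices because every use refutes membership.
    complete : (C : ConnSub G) → ¬ (C ∉ subtrees)
    complete C C∉ = <⇒≱ (length-unique≤ count
        (All.tabulate (λ {D} D∈ e → C∉ (subst (_∈ subtrees) (sym e) D∈)) ∷ subtrees!))
      (≤-trans tight (≤-trans bound≤codes (≤-reflexive (sym length-subtrees))))

    sums≤ : splits + mids ≤ m * halves k + triangle m
    sums≤ = +-cancelˡ-≤ (2 ^ k) _ _ (+-cancelˡ-≤ k _ _
      (≤-trans (≤-reflexive (sym length-codes′)) (≤-trans (codes≤coreIndex count) tight)))

    -- With `mids` at least its minimum, tightness leaves `splits` no slack, so every single split
    -- is minimal; `halves-tight` describes the minimisers.
    balanced : ∀ {v} → v ∈ inners →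
      Balanced k (cnt (λ i → L i ∧ desc v i)) (cnt (λ i → L i ∧ not (desc v i)))
    balanced {v} v∈ = subst (λ c → Balanced c x y) eq
      (halves-tight x y (subst (λ c → 2 ^ x + 2 ^ y ≤ halves c) (sym eq)
        (sum-tight (λ _ → halves k) split inners (λ _ → halves≤split _)
          (≤-trans (ℕₚ.+-cancelʳ-≤ (triangle m) _ _ (≤-trans (+-monoʳ-≤ splits mids≥) sums≤))
            (≤-reflexive (sym (sum-const (halves k) inners)))) v∈)))
      where
      x = cnt (λ i → L i ∧ desc v i)
      y = cnt (λ i → L i ∧ not (desc v i))
      eq : x + y ≡ k
      eq = cnt-split L (desc v)

    -- Tightness makes every middle weight equal to 1, whereas one pendant vertex in the component
    -- would raise it to at least 2.
    mid-pendantless : ∀ {p} → p ∈ pairs inners → ∀ {i} → L i ≡ true → mid p i ≡ true → ⊥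
    mid-pendantless {p} p∈ {i} Li e = <⇒≱
      (≤-trans (2≤2^suc 0) (^-monoʳ-≤ 2 (∃⇒cnt>0 (λ i → L i ∧ mid p i) i (cong₂ _∧_ Li e))))
      (sum-tight (λ _ → 1) (weight ∘ mid) (pairs inners)
        (λ {q} _ → m^n>0 2 (cnt (λ i → L i ∧ mid q i)))
        (≤-trans (+-cancelˡ-≤ (m * halves k) _ _ (≤-trans (+-monoˡ-≤ mids splits≥) sums≤))
          (≤-reflexive (sym triangle≡))) p∈)

    -- `pairs` contains `u` and `v` in only one of the two orders, and `mid` gives the same
    -- component for both.
    nested-pendantless : ∀ {u v i} → u ∈ inners → v ∈ inners → u ≢ v → desc v u ≡ true →
      L i ≡ true → desc v i ≡ true → desc u i ≡ false → ⊥
    nested-pendantless {u} {v} {i} u∈ v∈ u≢v vu Li vi ui with ∈-pairs⁺ u∈ v∈ u≢v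
    ... | inj₁ p∈ = mid-pendantless p∈ Li e
      where
      e : mid (u , v) i ≡ true
      e rewrite vu | vi | ui = refl
    ... | inj₂ p∈ = mid-pendantless p∈ Li e
      where
      e : mid (v , u) i ≡ true
      e rewrite vu | desc-antisym u≢v vu | vi | ui = refl

    apart-pendantless : ∀ {u v i} → u ∈ inners → v ∈ inners → u ≢ v → desc v u ≡ false → desc u v ≡ false →
      L i ≡ true → desc v i ≡ false → desc u i ≡ false → ⊥
    apart-pendantless {u} {v} {i} u∈ v∈ u≢v vu uv Li vi ui with ∈-pairs⁺ u∈ v∈ u≢v
    ... | inj₁ p∈ = mid-pendantless p∈ Li e
      where
      e : mid (u , v) i ≡ true
      e rewrite vu | uv | vi | ui = refl
    ... | inj₂ p∈ = mid-pendantless p∈ Li e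
      where
      e : mid (v , u) i ≡ true
      e rewrite vu | uv | vi | ui = refl

    parent-≢ : ∀ {v} → v ≢ r → v ≢ parent v
    parent-≢ {v} v≢r e = ℕₚ.1+n≢n (trans (sym (depth-p v≢r)) (cong depth e))

    -- Two children of an inner vertex v give the component of v after three edge removals.
    siblings-inner : ∀ {c c′} → c ∈ inners → c′ ∈ inners → c ≢ c′ → parent c ≡ parent c′ → parent c ≢ r → ⊥
    siblings-inner {c} {c′} c∈ c′∈ c≢c′ pc v≢r = complete (subtree {V} convex) λ C∈ →
      case ∈-reduce {P = Convex} (λ {V} → subtree {V}) codes-convex C∈ of λ { (W , W∈ , _ , e) →
        refute (subst (_∈ codes) (sym (cong ConnSub.V e)) W∈) }
      where
      v = parent c
      c≢r = proj₂ (inner⁻ c∈)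
      c′≢r = proj₂ (inner⁻ c′∈)
      Lv : L v ≡ false
      Lv = L-parent c≢r
      v∈ : v ∈ inners
      v∈ = inner⁺ Lv v≢r
      v≢c : v ≢ c
      v≢c = parent-≢ c≢r ∘ sym
      v≢c′ : v ≢ c′
      v≢c′ e = parent-≢ c′≢r (trans (sym e) pc)
      cv : desc c v ≡ false
      cv = desc-parent c≢r
      c′v : desc c′ v ≡ false
      c′v = trans (cong (desc c′) pc) (desc-parent c′≢r)
      S : Fin n → Bool
      S w = desc v w ∧ (not (desc c w) ∧ not (desc c′ w))
      V : Vec Bool n
      V = Vec.tabulate S
      shape : ConvexShape S
      shape = convex-shape v (c ∷ c′ ∷ []) Lv (cv ∷ c′v ∷ [])
        (λ {w} e → let p , q = ∧-true {desc v w} e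
                       s , t = ∧-true {not (desc c w)} q
                   in p , Boolₚ.not-injective {y = false} s ∷ Boolₚ.not-injective {y = false} t ∷ [])
        (λ p → λ { (s ∷ t ∷ []) → cong₂ _∧_ p (cong₂ (λ x y → not x ∧ not y) s t) })
      convex : Convex V
      convex = convex-fam {S} {V} shape (∈-fam⁺ L S V (λ i _ → lookup∘tabulate S i)
        (λ i e → trans (sym (lookup∘tabulate S i)) e))
      Sv : S v ≡ true
      Sv rewrite desc-self v | cv | c′v = refl
      Spv : S (parent v) ≡ false
      Spv rewrite desc-parent v≢r = refl
      Sc : S c ≡ false
      Sc rewrite desc-self c = Boolₚ.∧-zeroʳ (desc v c)
      Sc′ : S c′ ≡ false
      Sc′ rewrite desc-self c′ = trans (cong (desc v c′ ∧_) (Boolₚ.∧-zeroʳ (not (desc c c′)))) (Boolₚ.∧-zeroʳ (desc v c′))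
      refute : V ∈ codes → ⊥
      refute V∈ with ∈-codes⁻ V∈
      ... | inj₁ (x , Lx , e) = L≢ Lx Lv (sym (single-only x v
        (trans (cong (λ X → lookup X v) (sym e)) (trans (lookup∘tabulate S v) Sv))))
      -- The listed shape agrees with `S` off `L`, so it too cuts the edges above `v`, `c` and `c′`.
      ... | inj₂ (S′ , S′∈ , V∈S′) = shape-cuts S′∈ v∈ c∈ c′∈ v≢c v≢c′ c≢c′
        (λ e → true≢false (trans (sym e) (S′≡ v Lv Sv)) (S′≡ (parent v) (L-parent v≢r) Spv))
        (λ e → true≢false (trans e (S′≡ v Lv Sv)) (S′≡ c (proj₁ (inner⁻ c∈)) Sc))
        (λ e → true≢false (trans e (trans (cong S′ (sym pc)) (S′≡ v Lv Sv))) (S′≡ c′ (proj₁ (inner⁻ c′∈)) Sc′))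
        where
        S′≡ : ∀ i → L i ≡ false → ∀ {b} → S i ≡ b → S′ i ≡ b
        S′≡ i Li e = trans (sym (fam-off L S′ V V∈S′ i Li)) (trans (lookup∘tabulate S i) e)

    -- Removing the edges above both children leaves a middle component containing the root and the
    -- pendant vertex `x₀` on it. This is the purpose of rooting beside a pendant vertex: a root in
    -- the interior of the path could have two inner children.
    siblings-root : ∀ {c c′} → c ∈ inners → c′ ∈ inners → c ≢ c′ → parent c ≡ r → parent c′ ≡ r → ⊥
    siblings-root {c} {c′} c∈ c′∈ c≢c′ pc pc′ = apart-pendantless c∈ c′∈ c≢c′
      (under c∈ c′∈ c≢c′ pc) (under c′∈ c∈ (c≢c′ ∘ sym) pc′) Lx₀
      (under-x₀ c′∈) (under-x₀ c∈)
      where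
      under : ∀ {u v} → u ∈ inners → v ∈ inners → u ≢ v → parent u ≡ r → desc v u ≡ false
      under u∈ v∈ u≢v pu = trans (desc-step (proj₂ (inner⁻ u∈)) u≢v)
        (trans (cong (desc _) pu) (desc-of-root (proj₂ (inner⁻ v∈))))
      under-x₀ : ∀ {v} → v ∈ inners → desc v x₀ ≡ false
      under-x₀ v∈ = trans (desc-step (L≢ Lx₀ L-root) (L≢ Lx₀ (proj₁ (inner⁻ v∈))))
        (trans (cong (desc _) px₀) (desc-of-root (proj₂ (inner⁻ v∈))))

    parent-injective : ∀ {c c′} → c ∈ inners → c′ ∈ inners → parent c ≡ parent c′ → c ≡ c′
    parent-injective {c} {c′} c∈ c′∈ pc with c ≟ c′ | parent c ≟ r
    ... | yes e | _ = e
    ... | no c≢c′ | no v≢r = ⊥-elim (siblings-inner c∈ c′∈ c≢c′ pc v≢r)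
    ... | no c≢c′ | yes v≡r = ⊥-elim (siblings-root c∈ c′∈ c≢c′ v≡r (trans (sym pc) v≡r))

    -- The edges above `c` and above its parent would enclose a middle component that contains `x`.
    bearer-childless : ∀ {x c} → L x ≡ true → parent x ≢ r → c ∈ inners → parent c ≡ parent x → ⊥
    bearer-childless {x} {c} Lx px≢r c∈ pc = nested-pendantless c∈ (inner⁺ (L-parent x≢r) px≢r)
      (λ e → parent-≢ c≢r (trans e (sym pc)))
      (trans (desc-step c≢r (λ e → parent-≢ c≢r (trans e (sym pc)))) (trans (cong (desc v) pc) (desc-self v)))
      Lx
      (trans (desc-step x≢r (L≢ Lx (L-parent x≢r))) (desc-self v))
      (trans (desc-step x≢r (L≢ Lx (proj₁ (inner⁻ c∈)))) (trans (cong (desc c) (sym pc)) (desc-parent c≢r)))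
      where
      v = parent x
      x≢r : x ≢ r
      x≢r = L≢ Lx L-root
      c≢r = proj₂ (inner⁻ c∈)

    -- `G` itself, with all its edges, is a connected subgraph and so belongs to the list, whose
    -- members have tree edges only.
    linked : ∀ {i j} → adj G i j ≡ true → Link i j ⊎ Link j i
    linked {i} {j} ij with link? i j ⊎-dec link? j i
    ... | yes l = l
    ... | no ¬l = ⊥-elim (complete (connSub whole) λ C∈ →
      case ∈-reduce {P = Convex} (λ {V} → subtree {V}) codes-convex C∈ of λ { (W , _ , c , e) →
        ¬l (proj₂ (proj₂ (treeEdges⁻ W (trans (cong (λ D → lookup (lookup (ConnSub.E D) i) j) (sym e))
          (trans (lookE i j) ij))))) })
      where
      Vall : Vec Bool n
      Vall = Vec.tabulate (λ _ → true)
      Eall : Vec (Vec Bool n) n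
      Eall = Vec.tabulate λ i → Vec.tabulate (adj G i)
      lookV : ∀ i → lookup Vall i ≡ true
      lookV = lookup∘tabulate _
      lookE : ∀ i j → lookup (lookup Eall i) j ≡ adj G i j
      lookE i j = trans (cong (λ row → lookup row j) (lookup∘tabulate (λ i → Vec.tabulate (adj G i)) i))
        (lookup∘tabulate (adj G i) j)
      whole : IsConnSub G Vall Eall
      whole = isConnSub (r , lookV r)
        (λ i j → trans (lookE i j) (trans (Graph.sym G i j) (sym (lookE j i))))
        (λ i j e → trans (sym (lookE i j)) e , lookV i , lookV j)
        (λ u v _ _ → gmap id (λ {i} {j} e → trans (lookE i j) e) (conn u v))

    depth≡0 : ∀ {w} → depth w ≡ 0 → w ≡ r
    depth≡0 {w} e with w ≟ r
    ... | yes p = p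
    ... | no w≢r = case trans (sym e) (depth-p w≢r) of λ ()

    -- Two vertices of equal depth climb in step to the root, and `parent-injective` brings equality
    -- back down: the tree on the non-pendant vertices is a path.
    depth-injective : ∀ i → L i ≡ false → ∀ {j} → L j ≡ false → depth i ≡ depth j → i ≡ j
    depth-injective = depth-induction _
      (λ _ _ e → sym (depth≡0 (trans (sym e) depth-r)))
      (λ {i} i≢r ih Li {j} Lj e →
        let j≢r : j ≢ r
            j≢r = λ { refl → case trans (sym depth-r) (trans (sym e) (depth-p i≢r)) of λ () }
        in parent-injective (inner⁺ Li i≢r) (inner⁺ Lj j≢r)
             (ih (L-parent i≢r) (L-parent j≢r)
               (suc-injective (trans (sym (depth-p i≢r)) (trans e (depth-p j≢r))))))

    1≤⌊k/2⌋ : 1 ≤ ⌊ k /2⌋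
    1≤⌊k/2⌋ = ℕₚ.⌊n/2⌋-mono 2≤k

    abstract
      -- Balance at any inner vertex `v` puts at least `⌊ k /2⌋`, hence at least one, pendant vertex
      -- below `v`; those attached to the root are not below `v`.
      far-pendant : ∃ λ x → L x ≡ true × parent x ≢ r
      far-pendant = let x , e = cnt>0⇒∃ (λ i → L i ∧ desc v i) pos
                        Lx , vx = ∧-true {L x} e
                    in x , Lx , λ px → true≢false (trans (sym
                         (trans (desc-step (L≢ Lx L-root) (L≢ Lx (proj₁ (inner⁻ v∈)))) (cong (desc v) px))) vx)
                         (desc-of-root (proj₂ (inner⁻ v∈)))
        where
        some-inner : ∃ λ v → inner v ≡ true
        some-inner = cnt>0⇒∃ inner (subst (0 <_) (length-elems inner) 1≤m)
        v : Fin n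
        v = proj₁ some-inner
        v∈ : v ∈ inners
        v∈ = ∈-elems⁺ {M = inner} (proj₂ some-inner)
        pos : 0 < cnt (λ i → L i ∧ desc v i)
        pos with balanced v∈
        ... | inj₁ (e , _) = subst (0 <_) (sym e) 1≤⌊k/2⌋
        ... | inj₂ (e , _) = subst (0 <_) (sym e) (≤-trans 1≤⌊k/2⌋ (ℕₚ.⌊n/2⌋≤⌈n/2⌉ k))

    x₁ = proj₁ far-pendant
    v₁ = parent x₁

    Lx₁ : L x₁ ≡ true
    Lx₁ = proj₁ (proj₂ far-pendant)

    v₁≢r : v₁ ≢ r
    v₁≢r = proj₂ (proj₂ far-pendant)

    Lv₁ : L v₁ ≡ false
    Lv₁ = L-parent (L≢ Lx₁ L-root)

    v₁∈ : v₁ ∈ inners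
    v₁∈ = inner⁺ Lv₁ v₁≢r

    -- To get deeper than `parent x`, the path would have to continue through a child of it, which
    -- `bearer-childless` forbids.
    bearer-deepest : ∀ {x} → L x ≡ true → parent x ≢ r → ∀ w → L w ≡ false → depth w ≤ depth (parent x)
    bearer-deepest {x} Lx px≢r = depth-induction _
      (λ _ → subst (_≤ depth (parent x)) (sym depth-r) z≤n) step
      where
      step : ∀ {w} → w ≢ r → (L (parent w) ≡ false → depth (parent w) ≤ depth (parent x)) →
        L w ≡ false → depth w ≤ depth (parent x)
      step {w} w≢r ih Lw with depth (parent w) ℕ.≟ depth (parent x)
      ... | yes e = ⊥-elim (bearer-childless Lx px≢r (inner⁺ Lw w≢r)
        (depth-injective _ (L-parent w≢r) (L-parent (L≢ Lx L-root)) e))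
      ... | no ne = subst (_≤ depth (parent x)) (sym (depth-p w≢r)) (≤∧≢⇒< (ih (L-parent w≢r)) ne)

    bearer-unique : ∀ {x} → L x ≡ true → parent x ≢ r → parent x ≡ v₁
    bearer-unique {x} Lx px≢r = depth-injective _ Lpx Lv₁
      (≤-antisym (bearer-deepest Lx₁ v₁≢r _ Lpx) (bearer-deepest Lx px≢r _ Lv₁))
      where
      Lpx : L (parent x) ≡ false
      Lpx = L-parent (L≢ Lx L-root)

    ancestor : ∀ w → L w ≡ false → ∀ {q} → q ≤ depth w → ∃ λ u → L u ≡ false × depth u ≡ q
    ancestor = depth-induction _
      (λ Lr q≤ → r , Lr , trans depth-r (sym (ℕₚ.n≤0⇒n≡0 (subst (_ ≤_) depth-r q≤)))) step
      where
      step : ∀ {w} → w ≢ r → (L (parent w) ≡ false → ∀ {q} → q ≤ depth (parent w) → ∃ λ u → L u ≡ false × depth u ≡ q) →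
        L w ≡ false → ∀ {q} → q ≤ depth w → ∃ λ u → L u ≡ false × depth u ≡ q
      step {w} w≢r ih Lw {q} q≤ with q ℕ.≟ depth w
      ... | yes e = w , Lw , sym e
      ... | no ne = ih (L-parent w≢r) (≤-pred (subst (q <_) (depth-p w≢r) (≤∧≢⇒< q≤ ne)))

    -- Depth maps the `m + 1` non-pendant vertices bijectively onto 0, ..., `depth v₁`.
    depth-v₁ : depth v₁ ≡ m
    depth-v₁ = suc-injective (trans (≤-antisym
      (cnt-surject≥ (not ∘ L) depth (suc (depth v₁)) λ q q< →
        let u , Lu , e = ancestor v₁ Lv₁ (≤-pred q<) in u , cong not Lu , e)
      (cnt-inject≤ (not ∘ L) depth (suc (depth v₁))
        (λ p q → depth-injective _ (Boolₚ.not-injective {y = false} p) (Boolₚ.not-injective {y = false} q))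
        (λ i p → s≤s (bearer-deepest Lx₁ v₁≢r i (Boolₚ.not-injective {y = false} p))))) internals≡)

    depth≤m : ∀ {i} → L i ≡ false → depth i ≤ m
    depth≤m {i} Li = subst (depth i ≤_) depth-v₁ (bearer-deepest Lx₁ v₁≢r i Li)

    pos : Fin n → ℕ
    pos i = if L i then (if does (parent i ≟ r) then 0 else suc (suc m)) else suc (depth i)

    data Place (i : Fin n) : Set where
      path  : L i ≡ false → pos i ≡ suc (depth i) → Place i
      left  : L i ≡ true → parent i ≡ r → pos i ≡ 0 → Place i
      right : L i ≡ true → parent i ≡ v₁ → pos i ≡ suc (suc m) → Place i

    place : ∀ i → Place i
    place i with L i in Li | parent i ≟ r
    ... | false | _ = path Li (cong (λ b → if b then (if does (parent i ≟ r) then 0 else suc (suc m)) else suc (depth i)) Li)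
    ... | true | yes e = left Li e (cong₂ (λ b c → if b then (if c then 0 else suc (suc m)) else suc (depth i)) Li (dec-true (parent i ≟ r) e))
    ... | true | no ne = right Li (bearer-unique Li ne) (cong₂ (λ b c → if b then (if c then 0 else suc (suc m)) else suc (depth i)) Li (dec-false (parent i ≟ r) ne))

    pos≤ : ∀ i → pos i ≤ suc (suc m)
    pos≤ i with place i
    ... | path Li e = subst (_≤ suc (suc m)) (sym e) (s≤s (≤-trans (depth≤m Li) (n≤1+n m)))
    ... | left _ _ e = subst (_≤ suc (suc m)) (sym e) z≤n
    ... | right _ _ e = ≤-reflexive e

    pos-path : ∀ {i} → L i ≡ false → pos i ≡ suc (depth i)
    pos-path {i} Li with place i
    ... | path _ e = e
    ... | left p _ _ = ⊥-elim (true≢false p Li)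
    ... | right p _ _ = ⊥-elim (true≢false p Li)

    link⇒consecutive : ∀ {i j} → Link i j → Consecutive (pos i) (pos j)
    link⇒consecutive {i} (i≢r , refl) with place i | pos-path (L-parent i≢r)
    ... | path _ e | e′ = inj₂ (trans (cong suc e′) (trans (cong suc (sym (depth-p i≢r))) (sym e)))
    ... | left _ pi e | e′ = inj₁ (trans (cong suc e) (sym (trans e′ (cong suc (trans (cong depth pi) depth-r)))))
    ... | right _ pi e | e′ = inj₂ (trans (cong suc (trans e′ (cong suc (trans (cong depth pi) depth-v₁)))) (sym e))

    consecutive⇒adj : ∀ {i j} → suc (pos i) ≡ pos j → adj G i j ≡ true
    consecutive⇒adj {i} {j} e with place i | place j
    ... | path Li ei | path Lj ej = trans (Graph.sym G i j) (subst (λ z → adj G j z ≡ true)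
        (depth-injective _ (L-parent j≢r) Li (suc-injective (trans (sym (depth-p j≢r)) dj))) (adjacent j≢r))
      where
      dj : depth j ≡ suc (depth i)
      dj = suc-injective (trans (sym ej) (trans (sym e) (cong suc ei)))
      j≢r : j ≢ r
      j≢r refl = case trans (sym depth-r) dj of λ ()
    ... | path Li ei | left _ _ ej = case trans e ej of λ ()
    ... | path Li ei | right Lj pj ej = trans (Graph.sym G i j) (subst (λ z → adj G j z ≡ true)
        (trans pj (sym (depth-injective _ Li Lv₁ (trans
          (suc-injective (suc-injective (trans (cong suc (sym ei)) (trans e ej)))) (sym depth-v₁)))))
        (adjacent (L≢ Lj L-root)))
    ... | left Li pi ei | path Lj ej = subst (λ z → adj G i z ≡ true)
        (trans pi (sym (depth≡0 (suc-injective (trans (sym ej) (trans (sym e) (cong suc ei)))))))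
        (adjacent (L≢ Li L-root))
    ... | left Li pi ei | left _ _ ej = case trans e ej of λ ()
    ... | left Li pi ei | right _ _ ej = case trans (sym (trans e ej)) (cong suc ei) of λ ()
    ... | right _ _ ei | _ = ⊥-elim (<⇒≱ (n<1+n _) (subst (_≤ suc (suc m)) (trans (sym e) (cong suc ei)) (pos≤ j)))

    -- The level sizes are expressed through `desc v₁` so that they match `balanced` for the inner
    -- vertex `v₁`.
    levelled : Levelled G (suc m) (cnt (λ i → L i ∧ not (desc v₁ i))) (cnt (λ i → L i ∧ desc v₁ i))
    levelled = record
      { pos = pos
      ; pos≤ = pos≤
      ; adj⇒ = λ e → case linked e of λ { (inj₁ l) → link⇒consecutive l ; (inj₂ l) → Sum.swap (link⇒consecutive l) }
      ; adj⇐ = λ { (inj₁ e) → consecutive⇒adj e ; (inj₂ e) → trans (Graph.sym G _ _) (consecutive⇒adj e) }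
      ; pos-inj = pos-inj
      ; low≤ = cnt-mono λ i e → low i (does⁻ (pos i ℕ.≟ 0) e)
      ; high≤ = cnt-mono λ i e → high i (does⁻ (pos i ℕ.≟ suc (suc m)) e)
      }
      where
      middle-path : ∀ {i} → 1 ≤ pos i → pos i ≤ suc m → L i ≡ false
      middle-path {i} p q with place i
      ... | path Li _ = Li
      ... | left _ _ e = case subst (1 ≤_) e p of λ ()
      ... | right _ _ e = ⊥-elim (<⇒≱ (n<1+n _) (subst (_≤ suc m) e q))
      pos-inj : ∀ {i j} → 1 ≤ pos i → pos i ≤ suc m → pos i ≡ pos j → i ≡ j
      pos-inj {i} {j} p q e = depth-injective _ Li Lj
        (suc-injective (trans (sym (pos-path Li)) (trans e (pos-path Lj))))
        where
        Li = middle-path p q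
        Lj = middle-path (subst (1 ≤_) e p) (subst (_≤ suc m) e q)
      below-v₁ : ∀ {i} → L i ≡ true → desc v₁ i ≡ desc v₁ (parent i)
      below-v₁ Li = desc-step (L≢ Li L-root) (L≢ Li Lv₁)
      low : ∀ i → pos i ≡ 0 → L i ∧ not (desc v₁ i) ≡ true
      low i e with place i
      ... | path _ e′ = case trans (sym e) e′ of λ ()
      ... | right _ _ e′ = case trans (sym e) e′ of λ ()
      ... | left Li pi _ = cong₂ (λ x y → x ∧ not y) Li
        (trans (below-v₁ Li) (trans (cong (desc v₁) pi) (desc-of-root v₁≢r)))
      high : ∀ i → pos i ≡ suc (suc m) → L i ∧ desc v₁ i ≡ true
      high i e with place i
      ... | path Li e′ = ⊥-elim (<⇒≱ (≤-reflexive (sym (suc-injective (trans (sym e′) e)))) (depth≤m Li))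
      ... | left _ _ e′ = case trans (sym e) e′ of λ ()
      ... | right Li pi _ = cong₂ _∧_ Li (trans (below-v₁ Li) (trans (cong (desc v₁) pi) (desc-self v₁)))

-- Breadth-first spanning trees

module BreadthFirst {n} (G : Graph n) (conn : Connected G) (r : Fin n) where

  Within : ℕ → Fin n → Set
  Within zero u = u ≡ r
  Within (suc m) u = Within m u ⊎ ∃ λ w → Within m w × adj G u w ≡ true

  within? : ∀ m u → Dec (Within m u)
  within? zero u = u ≟ r
  within? (suc m) u = within? m u ⊎-dec any? λ w → within? m w ×-dec (adj G u w Bool.≟ true)

  reachable : ∀ {u} → Star (λ i j → adj G i j ≡ true) u r → ∃ λ m → Within m u
  reachable ε = 0 , refl
  reachable (e ◅ s) = let m , p = reachable s in suc m , inj₂ (_ , p , e)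

  abstract
    distance : ∀ u → ∃ λ m → Within m u × (∀ j → Within j u → m ≤ j)
    distance u = let m , p = reachable (conn u r) in least (λ m → Within m u) (λ m → within? m u) m p

  dist : Fin n → ℕ
  dist u = proj₁ (distance u)

  within-dist : ∀ u → Within (dist u) u
  within-dist u = proj₁ (proj₂ (distance u))

  dist-min : ∀ {u} j → Within j u → dist u ≤ j
  dist-min {u} = proj₂ (proj₂ (distance u))

  -- A vertex first reached in round `suc m` has a neighbour reached within `m` rounds; minimality
  -- at both vertices makes that neighbour's distance exactly `m`.
  closer : ∀ u → u ≢ r → ∃ λ w → adj G u w ≡ true × dist u ≡ suc (dist w)
  closer u u≢r with dist u in eq | within-dist u
  ... | zero | u≡r = ⊥-elim (u≢r u≡r)
  ... | suc m | inj₁ p = ⊥-elim (<⇒≱ (≤-reflexive (sym eq)) (dist-min m p))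
  ... | suc m | inj₂ (w , pw , uw) = w , uw , cong suc (≤-antisym
    (≤-pred (subst (_≤ suc (dist w)) eq (dist-min (suc (dist w)) (inj₂ (w , within-dist w , uw)))))
    (dist-min m pw))

  up : Fin n → Fin n
  up u with u ≟ r
  ... | yes _ = r
  ... | no u≢r = proj₁ (closer u u≢r)

  up-closer : ∀ {u} → u ≢ r → adj G u (up u) ≡ true × dist u ≡ suc (dist (up u))
  up-closer {u} u≢r with u ≟ r
  ... | yes e = ⊥-elim (u≢r e)
  ... | no u≢r′ = proj₂ (closer u u≢r′)

  spanningTree : (L : Fin n → Bool) → L r ≡ false →
    (∀ {x} → L x ≡ true → ∀ {i j} → adj G x i ≡ true → adj G x j ≡ true → i ≡ j) → SpanningTree G L
  spanningTree L Lr leaf = record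
    { r = r ; parent = up ; depth = dist
    ; adjacent = proj₁ ∘ up-closer
    ; depth-r = ℕₚ.n≤0⇒n≡0 (dist-min 0 refl)
    ; depth-p = proj₂ ∘ up-closer
    ; L-root = Lr
    ; L-parent = λ v≢r → not-true (λ Lw → parent-not-leaf v≢r Lw)
    }
    where
    -- The only neighbour of a vertex in `L` would be its child `v`, so `v` would also be its parent
    -- and `dist v` would exceed itself by two.
    parent-not-leaf : ∀ {v} → v ≢ r → L (up v) ≡ true → ⊥
    parent-not-leaf {v} v≢r Lw with up v ≟ r
    ... | yes e = true≢false Lw (trans (cong L e) Lr)
    ... | no w≢r with up-closer v≢r | up-closer w≢r
    ...   | vw , dv | ww , dw with leaf Lw (trans (Graph.sym G (up v) v) vw) ww
    ...     | e = <⇒≢ (n≤1+n (suc (dist v))) (trans dv (trans (cong suc dw) (cong (λ u → suc (suc (dist u))) (sym e))))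

-- Pendant vertices

isPendant : ∀ {n} → Graph n → Fin n → Bool
isPendant G i = degree G i ≡ᵇ 1

pendantCount≡cnt : ∀ {n} (G : Graph n) → pendantCount G ≡ cnt (isPendant G)
pendantCount≡cnt G = sum-indicator≡cnt (isPendant G)

pendant-neighbour-unique : ∀ {n} (G : Graph n) {x} → isPendant G x ≡ true →
  ∀ {i j} → adj G x i ≡ true → adj G x j ≡ true → i ≡ j
pendant-neighbour-unique G {x} Lx = cnt≡1⇒unique (adj G x)
  (trans (sym (sum-indicator≡cnt (adj G x))) (≡ᵇ⇒≡ (degree G x) 1 (subst T (sym Lx) tt)))

-- Two adjacent pendant vertices form a whole component, which a walk to the non-pendant `z` could
-- never leave.
pendant-support : ∀ {n} (G : Graph n) → Connected G → ∀ {x z} → isPendant G x ≡ true → isPendant G z ≡ false →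
  ∃ λ y → adj G x y ≡ true × isPendant G y ≡ false
pendant-support G conn {x} {z} Lx Lz with conn x z
... | ε = ⊥-elim (true≢false Lx Lz)
... | _◅_ {j = y} xy s = y , xy , not-true λ Ly → case trapped Ly (inj₂ refl) s of λ
    { (inj₁ refl) → true≢false Lx Lz ; (inj₂ refl) → true≢false Ly Lz }
  where
  trapped : isPendant G y ≡ true → ∀ {u} → u ≡ x ⊎ u ≡ y →
    Star (λ i j → adj G i j ≡ true) u z → z ≡ x ⊎ z ≡ y
  trapped Ly u∈ ε = u∈
  trapped Ly (inj₁ refl) (e ◅ s) = trapped Ly (inj₂ (pendant-neighbour-unique G Lx e xy)) s
  trapped Ly (inj₂ refl) (e ◅ s) =
    trapped Ly (inj₁ (pendant-neighbour-unique G Ly e (trans (Graph.sym G y x) xy))) s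

-- Isomorphism of levelled graphs

fibre : ∀ {n} → (Fin n → ℕ) → ℕ → ℕ
fibre f q = cnt (λ i → does (f i ℕ.≟ q))

-- Vertex `zero` is sent to some `j` with the same value, and both are deleted; the two fibres
-- concerned shrink by one each, so the inequalities persist.
fibre-permutation : ∀ {n} (f g : Fin n → ℕ) → (∀ q → fibre f q ≤ fibre g q) →
  Σ (Fin n ↔ Fin n) λ π → ∀ i → g (Inverse.to π i) ≡ f i
fibre-permutation {zero} f g le = Permutation.id , λ ()
fibre-permutation {suc n} f g le
  with cnt>0⇒∃ (λ i → does (g i ℕ.≟ f zero))
         (≤-trans (∃⇒cnt>0 (λ i → does (f i ℕ.≟ f zero)) zero (dec-true (f zero ℕ.≟ f zero) refl)) (le (f zero)))
... | j , e with fibre-permutation (f ∘ suc) (g ∘ punchIn j) rest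
  where
  rest : ∀ q → fibre (f ∘ suc) q ≤ fibre (g ∘ punchIn j) q
  rest q = +-cancelˡ-≤ (if does (f zero ℕ.≟ q) then 1 else 0) _ _
    (≤-trans (le q) (≤-reflexive (trans (cnt-punchIn (λ i → does (g i ℕ.≟ q)) j)
      (cong (λ z → (if does (z ℕ.≟ q) then 1 else 0) + fibre (g ∘ punchIn j) q) (does⁻ (g j ℕ.≟ f zero) e)))))
...   | π , h = Permutation.insert zero j π , λ { zero → does⁻ (g j ℕ.≟ f zero) e ; (suc i) → h i }

levelled-≅ : ∀ {n n′} {G : Graph n} {H : Graph n′} {d a b a′ b′} → n ≡ n′ →
  (lG : Levelled G d a b) (lH : Levelled H d a′ b′) →
  (∀ q → fibre (Levelled.pos lG) q ≤ fibre (Levelled.pos lH) q) → G ≅ H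
levelled-≅ {G = G} {H} refl lG lH le = proj₁ π , λ i j → bool-ext
  (λ e → H.adj⇐ (subst₂ Consecutive (sym (proj₂ π i)) (sym (proj₂ π j)) (G.adj⇒ e)))
  (λ e → G.adj⇐ (subst₂ Consecutive (proj₂ π i) (proj₂ π j) (H.adj⇒ e)))
  where
  module G = Levelled lG
  module H = Levelled lH
  π = fibre-permutation G.pos H.pos le

∸-step : ∀ N x → suc x ≤ N → suc (N ∸ suc x) ≡ N ∸ x
∸-step (suc N) zero _ = refl
∸-step (suc N) (suc x) (s≤s p) = ∸-step N x p

consecutive-∸ : ∀ {N x y} → x ≤ N → y ≤ N → Consecutive x y → Consecutive (N ∸ x) (N ∸ y)
consecutive-∸ x≤ y≤ (inj₁ refl) = inj₂ (∸-step _ _ y≤)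
consecutive-∸ x≤ y≤ (inj₂ refl) = inj₁ (∸-step _ _ x≤)

levelled-reverse : ∀ {n} {G : Graph n} {d a b} → Levelled G d a b → Levelled G d b a
levelled-reverse {G = G} {d} lev = record
  { pos = λ i → suc d ∸ pos i
  ; pos≤ = λ i → m∸n≤m (suc d) (pos i)
  ; adj⇒ = λ {i} {j} e → consecutive-∸ (pos≤ i) (pos≤ j) (adj⇒ e)
  ; adj⇐ = λ {i} {j} c → adj⇐ (subst₂ Consecutive (ℕₚ.m∸[m∸n]≡n (pos≤ i)) (ℕₚ.m∸[m∸n]≡n (pos≤ j))
      (consecutive-∸ (m∸n≤m (suc d) (pos i)) (m∸n≤m (suc d) (pos j)) c))
  ; pos-inj = λ {i} {j} p q e → pos-inj
      (ℕₚ.n≢0⇒n>0 λ z → <⇒≱ (n<1+n d) (subst (λ x → suc d ∸ x ≤ d) z q))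
      (≤-pred (ℕₚ.m∸n≢0⇒n<m {suc d} (λ z → case subst (1 ≤_) z p of λ ())))
      (ℕₚ.∸-cancelˡ-≡ (pos≤ i) (pos≤ j) e)
  ; low≤ = ≤-trans (cnt-mono λ i e → dec-true (pos i ℕ.≟ suc d)
      (≤-antisym (pos≤ i) (ℕₚ.m∸n≡0⇒m≤n (does⁻ (suc d ∸ pos i ℕ.≟ 0) e)))) high≤
  ; high≤ = ≤-trans (cnt-mono λ i e → dec-true (pos i ℕ.≟ 0)
      (ℕₚ.∸-cancelˡ-≡ (pos≤ i) z≤n (does⁻ (suc d ∸ pos i ℕ.≟ suc d) e))) low≤
  }
  where open Levelled lev

-- The trees T(a,b,d)

module TreeLevels (a b m : ℕ) where

  d : ℕ
  d = suc m

  -- A literal copy of the private arc relation behind `Tree`, so that adjacency there is `arcs` by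
  -- definition.
  arc : ℕ → ℕ → Bool
  arc x y =
    ((x <ᵇ a) ∧ (y ≡ᵇ a)) ∨
    (((a ≤ᵇ x) ∧ (suc x <ᵇ a + d)) ∧ (y ≡ᵇ suc x)) ∨
    ((a + d ≤ᵇ x) ∧ (y ≡ᵇ (a + d ∸ 1)))

  -- Truncated subtraction collapses the first `a` vertices to level 0, and the minimum collapses
  -- the last `b` to level `suc d`.
  level : ℕ → ℕ
  level x = (suc x ∸ a) ℕ.⊓ suc d

  level-low : ∀ {x} → x < a → level x ≡ 0
  level-low p = cong (ℕ._⊓ suc d) (ℕₚ.m≤n⇒m∸n≡0 p)

  level-path : ∀ {q} → q < d → level (a + q) ≡ suc q
  level-path {q} p = trans (cong (ℕ._⊓ suc d) (trans (cong (_∸ a) (sym (+-suc a q))) (ℕₚ.m+n∸m≡n a (suc q))))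
    (ℕₚ.m≤n⇒m⊓n≡m (s≤s (<⇒≤ p)))

  level-high : ∀ {x} → a + d ≤ x → level x ≡ suc d
  level-high {x} p = ℕₚ.m≥n⇒m⊓n≡n (≤-trans (≤-reflexive (sym (trans (cong (_∸ a) (sym (+-suc a d))) (ℕₚ.m+n∸m≡n a (suc d)))))
    (ℕₚ.∸-monoˡ-≤ a (s≤s p)))

  data Zone (x : ℕ) : Set where
    low  : x < a → level x ≡ 0 → Zone x
    path : ∀ q → q < d → x ≡ a + q → level x ≡ suc q → Zone x
    high : a + d ≤ x → level x ≡ suc d → Zone x

  zone : ∀ x → Zone x
  zone x with x <? a | a + d ≤? x
  ... | yes p | _ = low p (level-low p)
  ... | no _ | yes p = high p (level-high p)
  ... | no p | no q = path (x ∸ a) q<d (sym x≡) (trans (cong level (sym x≡)) (level-path q<d))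
    where
    x≡ : a + (x ∸ a) ≡ x
    x≡ = m+[n∸m]≡n (≮⇒≥ p)
    q<d : x ∸ a < d
    q<d = ℕₚ.+-cancelˡ-< a (x ∸ a) d (subst (_< a + d) (sym x≡) (≰⇒> q))

  T-true : ∀ {b} → b ≡ true → T b
  T-true refl = tt

  true-T : ∀ {b} → T b → b ≡ true
  true-T {true} _ = refl

  a+d∸1 : a + d ∸ 1 ≡ a + m
  a+d∸1 = cong (_∸ 1) (+-suc a m)

  arc⇒ : ∀ {x y} → arc x y ≡ true → Consecutive (level x) (level y)
  arc⇒ {x} {y} e with ∨-true {(x <ᵇ a) ∧ (y ≡ᵇ a)} e
  ... | inj₁ p = case ∧-true {x <ᵇ a} p of λ { (p₁ , p₂) → inj₁ (trans
          (cong suc (level-low (<ᵇ⇒< x a (T-true p₁))))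
          (sym (trans (cong level (trans (≡ᵇ⇒≡ y a (T-true p₂)) (sym (+-identityʳ a)))) (level-path {0} (s≤s z≤n))))) }
  ... | inj₂ p with ∨-true {((a ≤ᵇ x) ∧ (suc x <ᵇ a + d)) ∧ (y ≡ᵇ suc x)} p
  ...   | inj₁ q = case ∧-true {(a ≤ᵇ x) ∧ (suc x <ᵇ a + d)} q of λ { (q₁ , q₂) → case ∧-true {a ≤ᵇ x} q₁ of λ { (q₃ , q₄) →
          step (≤ᵇ⇒≤ a x (T-true q₃)) (<ᵇ⇒< (suc x) (a + d) (T-true q₄)) (≡ᵇ⇒≡ y (suc x) (T-true q₂)) } }
    where
    step : a ≤ x → suc x < a + d → y ≡ suc x → Consecutive (level x) (level y)
    step a≤x sx< refl = inj₁ (trans (cong suc (trans (cong level (sym x≡)) (level-path (<⇒≤ q<))))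
      (sym (trans (cong level (trans (cong suc (sym x≡)) (sym (+-suc a (x ∸ a))))) (level-path q<))))
      where
      x≡ : a + (x ∸ a) ≡ x
      x≡ = m+[n∸m]≡n a≤x
      q< : suc (x ∸ a) < d
      q< = ℕₚ.+-cancelˡ-< a _ d (subst (_< a + d) (trans (cong suc (sym x≡)) (sym (+-suc a (x ∸ a)))) sx<)
  ...   | inj₂ q = case ∧-true {a + d ≤ᵇ x} q of λ { (q₁ , q₂) → inj₂ (trans
          (cong suc (trans (cong level (trans (≡ᵇ⇒≡ y (a + d ∸ 1) (T-true q₂)) a+d∸1)) (level-path {m} ≤-refl)))
          (sym (level-high (≤ᵇ⇒≤ (a + d) x (T-true q₁))))) }

  arc-low : ∀ {x} → x < a → arc x a ≡ true
  arc-low {x} p rewrite true-T (<⇒<ᵇ p) | true-T (≡⇒≡ᵇ a a refl) = refl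

  arc-path : ∀ {q} → suc q < d → arc (a + q) (a + suc q) ≡ true
  arc-path {q} p rewrite true-T (≤⇒≤ᵇ (m≤m+n a q)) | +-suc a q
    | true-T (<⇒<ᵇ (subst (_< a + d) (+-suc a q) (ℕₚ.+-monoʳ-< a p))) | true-T (≡⇒≡ᵇ (suc (a + q)) (suc (a + q)) refl) =
    Boolₚ.∨-zeroʳ _

  arc-high : ∀ {x} → a + d ≤ x → arc x (a + m) ≡ true
  arc-high {x} p rewrite true-T (≤⇒≤ᵇ p) | a+d∸1 | true-T (≡⇒≡ᵇ (a + m) (a + m) refl) =
    trans (cong (((x <ᵇ a) ∧ (a + m ≡ᵇ a)) ∨_) (Boolₚ.∨-zeroʳ _)) (Boolₚ.∨-zeroʳ _)

  arcs : ℕ → ℕ → Bool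
  arcs x y = not (x ≡ᵇ y) ∧ (arc x y ∨ arc y x)

  arcs⁺ : ∀ {x y} → x ≢ y → arc x y ≡ true ⊎ arc y x ≡ true → arcs x y ≡ true
  arcs⁺ {x} {y} ne p rewrite not-true {x ≡ᵇ y} (λ e → ne (≡ᵇ⇒≡ x y (T-true e))) = either p
    where
    either : arc x y ≡ true ⊎ arc y x ≡ true → arc x y ∨ arc y x ≡ true
    either (inj₁ e) = cong (_∨ arc y x) e
    either (inj₂ e) = trans (cong (arc x y ∨_) e) (Boolₚ.∨-zeroʳ (arc x y))

  -- At both ends `arc` points from the pendant vertex to the path, so at the upper end it runs
  -- against the levels.
  up-arc : ∀ {x y} → suc (level x) ≡ level y → arc x y ≡ true ⊎ arc y x ≡ true
  up-arc {x} {y} e with zone x | zone y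
  ... | low p lx | low _ ly = case trans e ly of λ ()
  ... | low p lx | path q q<d y≡ ly with trans (sym ly) (trans (sym e) (cong suc lx))
  ...   | refl = inj₁ (subst (λ z → arc x z ≡ true) (sym (trans y≡ (+-identityʳ a))) (arc-low p))
  up-arc {x} {y} e | low p lx | high _ ly = case trans (sym (trans e ly)) (cong suc lx) of λ ()
  up-arc {x} {y} e | path q q<d x≡ lx | low _ ly = case trans e ly of λ ()
  up-arc {x} {y} e | path q q<d x≡ lx | path q′ q′<d y≡ ly with trans (sym ly) (trans (sym e) (cong suc lx))
  ... | refl = inj₁ (subst₂ (λ z w → arc z w ≡ true) (sym x≡) (sym y≡) (arc-path q′<d))
  up-arc {x} {y} e | path q q<d x≡ lx | high p ly with trans (sym ly) (trans (sym e) (cong suc lx))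
  ... | refl = inj₂ (subst (λ z → arc y z ≡ true) (sym x≡) (arc-high p))
  up-arc {x} {y} e | high _ lx | _ = ⊥-elim (<⇒≱ (n<1+n (suc d))
    (subst (_≤ suc d) (trans (sym e) (cong suc lx)) (ℕₚ.m⊓n≤n (suc y ∸ a) (suc d))))

  arcs⇐ : ∀ {x y} → Consecutive (level x) (level y) → arcs x y ≡ true
  arcs⇐ (inj₁ e) = arcs⁺ (λ { refl → ℕₚ.1+n≢n e }) (up-arc e)
  arcs⇐ (inj₂ e) = arcs⁺ (λ { refl → ℕₚ.1+n≢n e }) (Sum.swap (up-arc e))

  arcs⇒ : ∀ {x y} → arcs x y ≡ true → Consecutive (level x) (level y)
  arcs⇒ {x} {y} e = case ∨-true {arc x y} (proj₂ (∧-true {not (x ≡ᵇ y)} e)) of λ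
    { (inj₁ p) → arc⇒ p ; (inj₂ p) → Sum.swap (arc⇒ p) }

  size : a + b + d ≡ a + d + b
  size = trans (+-assoc a b d) (trans (cong (a +_) (+-comm b d)) (sym (+-assoc a d b)))

  low⁻ : ∀ {x} → level x ≡ 0 → x < a
  low⁻ {x} e with zone x
  ... | low p _ = p
  ... | path _ _ _ l = case trans (sym e) l of λ ()
  ... | high _ l = case trans (sym e) l of λ ()

  high⁻ : ∀ {x} → level x ≡ suc d → a + d ≤ x
  high⁻ {x} e with zone x
  ... | low _ l = case trans (sym e) l of λ ()
  ... | path _ q<d _ l = ⊥-elim (<⇒≢ q<d (suc-injective (trans (sym l) e)))
  ... | high p _ = p

  level-injective : ∀ {x y} → 1 ≤ level x → level x ≤ d → level x ≡ level y → x ≡ y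
  level-injective {x} {y} 1≤ ≤d e with zone x | zone y
  ... | low _ l | _ = case subst (1 ≤_) l 1≤ of λ ()
  ... | high _ l | _ = ⊥-elim (<⇒≱ (n<1+n d) (subst (_≤ d) l ≤d))
  ... | path _ _ _ l | low _ l′ = case trans (sym l) (trans e l′) of λ ()
  ... | path q q<d x≡ l | high _ l′ = ⊥-elim (<⇒≱ (n<1+n d) (subst (_≤ d) (trans e l′) ≤d))
  ... | path q q<d x≡ l | path q′ _ y≡ l′ =
    trans x≡ (trans (cong (a +_) (suc-injective (trans (sym l) (trans e l′)))) (sym y≡))

  levelled : Levelled (Tree a b d) d a b
  levelled = record
    { pos = level ∘ toℕ
    ; pos≤ = λ i → ℕₚ.m⊓n≤n (suc (toℕ i) ∸ a) (suc d)
    ; adj⇒ = λ {i} {j} → arcs⇒ {toℕ i} {toℕ j}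
    ; adj⇐ = λ {i} {j} → arcs⇐ {toℕ i} {toℕ j}
    ; pos-inj = λ p q e → toℕ-injective (level-injective p q e)
    ; low≤ = cnt-inject≤ {a + b + d} (λ i → does (level (toℕ i) ℕ.≟ 0)) toℕ a (λ _ _ → toℕ-injective)
        (λ i e → low⁻ (does⁻ (level (toℕ i) ℕ.≟ 0) e))
    ; high≤ = cnt-inject≤ {a + b + d} (λ i → does (level (toℕ i) ℕ.≟ suc d)) (λ i → toℕ i ∸ (a + d)) b
        (λ {i} {j} p q e → toℕ-injective (ℕₚ.∸-cancelʳ-≡ (above i p) (above j q) e))
        (λ i p → ℕₚ.+-cancelˡ-< (a + d) _ b (subst₂ _<_ (sym (m+[n∸m]≡n (above i p))) size (toℕ<n i)))
    }
    where
    above : ∀ i → does (level (toℕ i) ℕ.≟ suc d) ≡ true → a + d ≤ toℕ i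
    above i e = high⁻ (does⁻ (level (toℕ i) ℕ.≟ suc d) e)

  vertex : ∀ x → x < a + d + b → ∃ λ (i : Fin (a + b + d)) → toℕ i ≡ x
  vertex x p = fromℕ< (subst (x <_) (sym size) p) , toℕ-fromℕ< _

  low≥ : a ≤ fibre {a + b + d} (level ∘ toℕ) 0
  low≥ = cnt-surject≥ (λ i → does (level (toℕ i) ℕ.≟ 0)) toℕ a λ q q<a →
    case vertex q (<-≤-trans q<a (≤-trans (m≤m+n a d) (m≤m+n (a + d) b))) of λ
      { (i , refl) → i , dec-true (level (toℕ i) ℕ.≟ 0) (level-low q<a) , refl }

  high≥ : b ≤ fibre {a + b + d} (level ∘ toℕ) (suc d)
  high≥ = cnt-surject≥ (λ i → does (level (toℕ i) ℕ.≟ suc d)) (λ i → toℕ i ∸ (a + d)) b λ q q<b →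
    case vertex (a + d + q) (ℕₚ.+-monoʳ-< (a + d) q<b) of λ
      { (i , e) → i , dec-true (level (toℕ i) ℕ.≟ suc d) (level-high (subst (a + d ≤_) (sym e) (m≤m+n (a + d) q))) ,
                  trans (cong (_∸ (a + d)) e) (ℕₚ.m+n∸m≡n (a + d) q) }

  path≥ : ∀ q → q < d → 1 ≤ fibre {a + b + d} (level ∘ toℕ) (suc q)
  path≥ q q<d = case vertex (a + q) (<-≤-trans (ℕₚ.+-monoʳ-< a q<d) (m≤m+n (a + d) b)) of λ
    { (i , e) → ∃⇒cnt>0 _ i (dec-true (level (toℕ i) ℕ.≟ suc q) (trans (cong level e) (level-path q<d))) }

  -- Every level of `G` is at most as large as the same level of the tree: `G` has upper bounds on
  -- its level sizes, the tree the matching lower bounds.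
  levelled⇒≅ : ∀ {n} {G : Graph n} → n ≡ a + b + d → Levelled G d a b → G ≅ Tree a b d
  levelled⇒≅ n≡ lG = levelled-≅ n≡ lG levelled fibres
    where
    module G = Levelled lG
    fibres : ∀ q → fibre G.pos q ≤ fibre {a + b + d} (level ∘ toℕ) q
    fibres zero = ≤-trans G.low≤ low≥
    fibres (suc q) with suc q ≤? d
    ... | yes q<d = ≤-trans
      (cnt-inject≤ (λ i → does (G.pos i ℕ.≟ suc q)) (λ _ → 0) 1
        (λ {i} {j} p p′ _ → let e = does⁻ (G.pos i ℕ.≟ suc q) p in G.pos-inj
          (subst (1 ≤_) (sym e) (s≤s z≤n)) (subst (_≤ d) (sym e) q<d)
          (trans e (sym (does⁻ (G.pos j ℕ.≟ suc q) p′))))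
        (λ _ _ → s≤s z≤n))
      (path≥ q q<d)
    ... | no q≮d with q ℕ.≟ d
    ...   | yes refl = ≤-trans G.high≤ high≥
    ...   | no q≢d = ≤-trans (≤-reflexive (cnt≡0 {M = λ i → does (G.pos i ℕ.≟ suc q)} λ i e →
      q≮d (≤∧≢⇒< (≤-pred (subst (_≤ suc d) (does⁻ (G.pos i ℕ.≟ suc q) e) (G.pos≤ i))) q≢d))) z≤n

-- Comparison with the balanced tree

halfTree-≤ : ∀ {k m d b} → d ≡ suc m → CoreIndex (Tree ⌊ k /2⌋ ⌈ k /2⌉ d) b → b ≤ bound k m
halfTree-≤ {k} {m} refl e = ≤-trans (LevelledBound.coreIndex≤ (TreeLevels.levelled ⌊ k /2⌋ ⌈ k /2⌉ m) e)
  (≤-reflexive (cong₂ _+_ half (cong₂ _+_ (cong (2 ^_) half)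
    (trans (sym (+-assoc (m * 2 ^ ⌊ k /2⌋) (m * 2 ^ ⌈ k /2⌉) (triangle m)))
      (cong (_+ triangle m) (sym (ℕₚ.*-distribˡ-+ m (2 ^ ⌊ k /2⌋) (2 ^ ⌈ k /2⌉))))))))
  where
  half : ⌊ k /2⌋ + ⌈ k /2⌉ ≡ k
  half = ⌊n/2⌋+⌈n/2⌉≡n k

-- `Balanced` does not say which end carries the larger half; if the ends come in the wrong order,
-- the path is read backwards.
balanced⇒≅ : ∀ {n k m d x y} {G : Graph n} → d ≡ suc m → k + d ≡ n → Balanced k x y →
  Levelled G (suc m) y x → G ≅ Tree ⌊ k /2⌋ ⌈ k /2⌉ d
balanced⇒≅ {n} {k} {m} refl k+d≡n (inj₂ (refl , refl)) lev =
  TreeLevels.levelled⇒≅ ⌊ k /2⌋ ⌈ k /2⌉ m (trans (sym k+d≡n) (cong (_+ suc m) (sym (⌊n/2⌋+⌈n/2⌉≡n k)))) lev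
balanced⇒≅ {n} {k} {m} refl k+d≡n (inj₁ (refl , refl)) lev =
  TreeLevels.levelled⇒≅ ⌊ k /2⌋ ⌈ k /2⌉ m (trans (sym k+d≡n) (cong (_+ suc m) (sym (⌊n/2⌋+⌈n/2⌉≡n k))))
    (levelled-reverse lev)

theorem5p5 : (n k : ℕ) → 4 ≤ n → 2 ≤ k → k ≤ n ∸ 2 →
    (G : Graph n) → Connected G → pendantCount G ≡ k →
    Σ ℕ λ a → Σ ℕ λ b →
    CoreIndex G a × CoreIndex (Tree ⌊ k /2⌋ ⌈ k /2⌉ (n ∸ k)) b ×
    b ≤ a × (a ≡ b ⇔ G ≅ Tree ⌊ k /2⌋ ⌈ k /2⌉ (n ∸ k))
theorem5p5 n .(pendantCount G) 4≤n 2≤k k≤n∸2 G conn refl =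
  a , b , countG , countH , ≤-trans b≤bound bound≤a , mk⇔ equality invariance
  where
  L : Fin n → Bool
  L = isPendant G
  k≡ : cnt L ≡ pendantCount G
  k≡ = sym (pendantCount≡cnt G)
  H = Tree ⌊ pendantCount G /2⌋ ⌈ pendantCount G /2⌉ (n ∸ pendantCount G)
  a = proj₁ (coreIndex G)
  b = proj₁ (coreIndex H)
  countG : CoreIndex G a
  countG = proj₂ (coreIndex G)
  countH : CoreIndex H b
  countH = proj₂ (coreIndex H)
  k+internals : pendantCount G + cnt (not ∘ L) ≡ n
  k+internals = trans (cong (_+ cnt (not ∘ L)) (sym k≡)) (cnt-complement L)
  d≡ : n ∸ pendantCount G ≡ cnt (not ∘ L)
  d≡ = trans (cong (_∸ pendantCount G) (sym k+internals)) (ℕₚ.m+n∸m≡n (pendantCount G) _)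
  2≤d : 2 ≤ cnt (not ∘ L)
  2≤d = +-cancelˡ-≤ (pendantCount G) 2 _ (subst (pendantCount G + 2 ≤_) (sym k+internals)
    (subst (pendantCount G + 2 ≤_) (m∸n+n≡m (≤-trans (s≤s (s≤s z≤n)) 4≤n)) (+-monoˡ-≤ 2 k≤n∸2)))
  somePendant : ∃ λ x → L x ≡ true
  somePendant = cnt>0⇒∃ L (subst (0 <_) (sym k≡) (≤-trans (s≤s z≤n) 2≤k))
  someInternal : ∃ λ z → not (L z) ≡ true
  someInternal = cnt>0⇒∃ (not ∘ L) (≤-trans (s≤s z≤n) 2≤d)
  x₀ : Fin n
  x₀ = proj₁ somePendant
  -- The root: as some vertex is not pendant, the neighbour of the pendant `x₀` is not pendant
  -- either.
  support : ∃ λ y → adj G x₀ y ≡ true × L y ≡ false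
  support = pendant-support G conn (proj₂ somePendant) (Boolₚ.not-injective {y = false} (proj₂ someInternal))
  r : Fin n
  r = proj₁ support
  tree : SpanningTree G L
  tree = BreadthFirst.spanningTree G conn r L (proj₂ (proj₂ support)) (pendant-neighbour-unique G)
  open SpanningTree tree using (parent; adjacent)
  open TreeBound tree using (desc)
  module Bound = TreeTight tree
  x₀≢r : x₀ ≢ r
  x₀≢r e = true≢false (proj₂ somePendant) (trans (cong L e) (proj₂ (proj₂ support)))
  px₀ : parent x₀ ≡ r
  px₀ = pendant-neighbour-unique G (proj₂ somePendant) (adjacent x₀≢r) (proj₁ (proj₂ support))
  d≡suc-m : n ∸ pendantCount G ≡ suc Bound.m
  d≡suc-m = trans d≡ Bound.internals≡
  b≤bound : b ≤ bound (pendantCount G) Bound.m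
  b≤bound = halfTree-≤ d≡suc-m countH
  bound≤a : bound (pendantCount G) Bound.m ≤ a
  bound≤a = subst (λ c → bound c Bound.m ≤ a) k≡ (Bound.bound≤coreIndex countG)
  invariance : G ≅ H → a ≡ b
  invariance iso = ≤-antisym (coreIndex-≅ iso countG countH) (coreIndex-≅ (≅-sym {G = G} {H} iso) countH countG)
  equality : a ≡ b → G ≅ H
  equality a≡b = balanced⇒≅ d≡suc-m (trans (cong (pendantCount G +_) d≡) k+internals)
    (subst (λ c → Balanced c (cnt λ i → L i ∧ desc Ext.v₁ i) (cnt λ i → L i ∧ not (desc Ext.v₁ i))) k≡
      (Ext.balanced Ext.v₁∈)) Ext.levelled
    where
    -- From `a ≡ b` and `b≤bound`, `G` attains the bound; `1 ≤ m` comes from having at least two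
    -- non-pendant vertices.
    module Ext = Bound.Extremal conn countG
      (subst (λ c → a ≤ bound c Bound.m) (sym k≡) (subst (_≤ bound (pendantCount G) Bound.m) (sym a≡b) b≤bound))
      (proj₂ somePendant) px₀ (subst (2 ≤_) (sym k≡) 2≤k)
      (≤-pred (subst (2 ≤_) Bound.internals≡ 2≤d))
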